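{- Let $q$ be a prime power and $n\ge1$. The extension of any semifield spread of $W(2n-1,q)$ to a partial spread of $H(2n-1,q^2)$ is maximal, i.e. it is not strictly contained in a larger partial spread of $H(2n-1,q^2)$.
   Context: For $x\in\mathbb{F}_{q^2}$ let $\overline{x}=x^q$, applied entrywise to matrices. $H(2n-1,q^2)$ is the hermitian polar space: the totally isotropic subspaces of $\mathrm{PG}(2n-1,q^2)$ with respect to the non-degenerate hermitian form with matrix $\begin{pmatrix}0_n& aI_n\\ -aI_n&0_n\end{pmatrix}$, where $a\in\mathbb{F}_{q^2}^\times$ with $\overline{a}=-a$. $W(2n-1,q)$ is the symplectic polar space: the totally isotropic subspaces of $\mathrm{PG}(2n-1,q)\subseteq\mathrm{PG}(2n-1,q^2)$ with respect to the symplectic form with matrix $\begin{pmatrix}0_n& I_n\\ -I_n&0_n\end{pmatrix}$. A partial spread of a polar space is a set of pairwise disjoint $(n-1)$-dimensional (projective) subspaces of it; a spread is a partial spread covering all points. For an $n\times n$ matrix $A$ let $S_A=\langle (u,Au)^T : u\ne 0\rangle$ and $S_\infty=\langle (0,u)^T: u\neq 0\rangle$. A semifield spread of $W(2n-1,q)$ is a spread that is equivalent (under an isometry of the polar space) to $D_U=\{S_A:A\in U\}\cup\{S_\infty\}$ where $U$ is a set of $q^n$ symmetric $n\times n$ matrices over $\mathbb{F}_q$, closed under addition (and under scalar multiplication by some subfield of $\mathbb{F}_q$), with every nonzero element invertible (a linear spread set). The extension of a partial spread $D$ of $W(2n-1,q)$ is the set of subspaces of $\mathrm{PG}(2n-1,q^2)$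 obtained by extending scalars of each element of $D$ from $\mathbb{F}_q$ to $\mathbb{F}_{q^2}$; it is a partial spread of $H(2n-1,q^2)$. -}

module Defs where

open import Level using (0ℓ)
open import Data.Nat using (ℕ; zero; suc; _^_)
open import Data.Fin using (Fin; zero; suc)
open import Data.Product using (_×_; _,_; ∃)
open import Data.Sum using (_⊎_)
open import Relation.Nullary using (¬_)
open import Relation.Binary.PropositionalEquality using (_≡_; _≢_; setoid)
open import Algebra.Core using (Op₁; Op₂)
open import Function.Bundles using (_↔_)
import Algebra.Structures as AS

-- A finite field, with propositional equality on the carrier
-- (every finite field is isomorphic to one of this shape).

record FiniteField : Set₁ where
  infixl 6 _+_
  infixl 7 _*_
  field
    Carrier : Set
    _+_ _*_ : Op₂ Carrier
    -_      : Op₁ Carrier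
    0# 1#   : Carrier
    isCommutativeRing : AS.IsCommutativeRing {A = Carrier} _≡_ _+_ _*_ -_ 0# 1#
    0≢1     : 0# ≢ 1#
    inverse : ∀ x → x ≢ 0# → ∃ λ y → x * y ≡ 1#
    size    : ℕ
    enum    : Carrier ↔ Fin size

module Geometry (K : FiniteField) (q : ℕ) where
  open FiniteField K

  pow : Carrier → ℕ → Carrier
  pow x zero    = 1#
  pow x (suc m) = x * pow x m

  conj : Carrier → Carrier
  conj x = pow x q

  InFq : Carrier → Set
  InFq x = conj x ≡ x

  Σ : ∀ n → (Fin n → Carrier) → Carrier
  Σ zero    f = 0#
  Σ (suc n) f = f zero + Σ n (λ i → f (suc i))

  Vect : ℕ → Set
  Vect n = Fin n → Carrier

  Mat : ℕ → Set
  Mat n = Fin n → Fin n → Carrier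

  Vect2 : ℕ → Set
  Vect2 n = Vect n × Vect n

  _·_ : ∀ {n} → Mat n → Vect n → Vect n
  (A · u) i = Σ _ (λ j → A i j * u j)

  _⊕_ : ∀ {n} → Vect n → Vect n → Vect n
  (u ⊕ v) i = u i + v i

  _⊞_ : ∀ {n} → Mat n → Mat n → Mat n
  (A ⊞ B) i j = A i j + B i j

  _⊠_ : ∀ {n} → Mat n → Mat n → Mat n
  (A ⊠ B) i j = Σ _ (λ k → A i k * B k j)

  idM : ∀ {n} → Mat n
  idM {suc n} zero    zero    = 1#
  idM {suc n} zero    (suc j) = 0#
  idM {suc n} (suc i) zero    = 0#
  idM {suc n} (suc i) (suc j) = idM {n} i j

  zeroM : ∀ {n} → Mat n
  zeroM i j = 0#

  _≐_ : ∀ {n} → Vect n → Vect n → Set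
  u ≐ v = ∀ i → u i ≡ v i

  _≐M_ : ∀ {n} → Mat n → Mat n → Set
  A ≐M B = ∀ i j → A i j ≡ B i j

  _≐₂_ : ∀ {n} → Vect2 n → Vect2 n → Set
  (x , y) ≐₂ (x' , y') = (x ≐ x') × (y ≐ y')

  IsZero : ∀ {n} → Vect n → Set
  IsZero u = ∀ i → u i ≡ 0#

  IsZero₂ : ∀ {n} → Vect2 n → Set
  IsZero₂ (x , y) = IsZero x × IsZero y

  VectFq : ∀ {n} → Vect n → Set
  VectFq u = ∀ i → InFq (u i)

  MatFq : ∀ {n} → Mat n → Set
  MatFq A = ∀ i j → InFq (A i j)

  Symmetric : ∀ {n} → Mat n → Set
  Symmetric A = ∀ i j → A i j ≡ A j i

  Invertible : ∀ {n} → Mat n → Set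
  Invertible {n} A = ∃ λ (B : Mat n) → (A ⊠ B) ≐M idM

  -- Hermitian form with matrix [[0, aI],[-aI, 0]]:
  --   h((x,y),(x',y')) = Σ_i ( a x_i ȳ'_i - a y_i x̄'_i )
  herm : ∀ {n} → Carrier → Vect2 n → Vect2 n → Carrier
  herm {n} a (x , y) (x' , y') =
    Σ n (λ i → a * x i * conj (y' i) + - (a * y i * conj (x' i)))

  -- Symplectic form with matrix [[0, I],[-I, 0]]
  sympl : ∀ {n} → Vect2 n → Vect2 n → Carrier
  sympl {n} (x , y) (x' , y') = Σ n (λ i → x i * y' i + - (y i * x' i))

  -- An n-dimensional subspace of K^{2n} (an (n-1)-space of PG(2n-1,q^2)),
  -- given as the column space of a 2n × n matrix [P ; Q] of rank n.
  record Gen (n : ℕ) : Set where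
    constructor gen
    field
      top bot : Mat n

  apply : ∀ {n} → Gen n → Vect n → Vect2 n
  apply (gen P Q) u = (P · u , Q · u)

  FullRank : ∀ {n} → Gen n → Set
  FullRank M = ∀ u → IsZero₂ (apply M u) → IsZero u

  TotIsoH : ∀ {n} → Carrier → Gen n → Set
  TotIsoH a M = ∀ u v → herm a (apply M u) (apply M v) ≡ 0#

  Meet : ∀ {n} → Gen n → Gen n → Set
  Meet M N = ∃ λ u → ∃ λ v → ¬ IsZero u × (apply M u ≐₂ apply N v)

  record Block (n : ℕ) : Set where
    constructor block
    field
      g₁₁ g₁₂ g₂₁ g₂₂ : Mat n

  act : ∀ {n} → Block n → Vect2 n → Vect2 n
  act (block a b c d) (x , y) = ((a · x) ⊕ (b · y) , (c · x) ⊕ (d · y))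

  BlockFq : ∀ {n} → Block n → Set
  BlockFq (block a b c d) = MatFq a × MatFq b × MatFq c × MatFq d

  BlockInvertible : ∀ {n} → Block n → Set
  BlockInvertible {n} g =
    ∃ λ (h : Block n) → BlockFq h × (∀ w → act h (act g w) ≐₂ w)

  -- g is an isometry (similitude) of W(2n-1,q): it preserves the
  -- symplectic form on F_q^{2n} up to a nonzero scalar λ ∈ F_q
  IsometryW : ∀ {n} → Block n → Set
  IsometryW {n} g = BlockFq g × BlockInvertible g ×
    ∃ λ (l : Carrier) → InFq l × l ≢ 0# ×
      (∀ (w w' : Vect2 n) → (VectFq (Data.Product.proj₁ w) × VectFq (Data.Product.proj₂ w)) →
         (VectFq (Data.Product.proj₁ w') × VectFq (Data.Product.proj₂ w')) →
         sympl (act g w) (act g w') ≡ l * sympl w w')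

  -- g · S_A, as the column space of g · [I ; A]
  gS : ∀ {n} → Block n → Mat n → Gen n
  gS (block a b c d) A = gen (a ⊞ (b ⊠ A)) (c ⊞ (d ⊠ A))

  -- g · S_∞, as the column space of g · [0 ; I]
  gS∞ : ∀ {n} → Block n → Gen n
  gS∞ (block a b c d) = gen b d

  record LinearSpreadSet (n : ℕ) : Set where
    field
      card   : ℕ
      elem   : Fin card → Mat n
      card≡  : card ≡ q ^ n
      distinct : ∀ i j → elem i ≐M elem j → i ≡ j
      overFq   : ∀ i → MatFq (elem i)
      symm     : ∀ i → Symmetric (elem i)
      addClosed : ∀ i j → ∃ λ k → elem k ≐M (elem i ⊞ elem j)
      nonzeroInv : ∀ i → ¬ (elem i ≐M zeroM) → Invertible (elem i)

  -- The extension to F_{q^2} of the semifield spread g(D_U), where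
  -- D_U = {S_A : A ∈ U} ∪ {S_∞}, is maximal as a partial spread of
  -- H(2n-1,q^2): every totally isotropic n-dimensional F_{q^2}-subspace W
  -- meets some member of it nontrivially (so no member can be added).
  MaximalExtension : ∀ {n} → Carrier → LinearSpreadSet n → Block n → Set
  MaximalExtension {n} a U g =
    ∀ (W : Gen n) → FullRank W → TotIsoH a W →
      (∃ λ i → Meet W (gS g (LinearSpreadSet.elem U i))) ⊎ Meet W (gS∞ g)

{-# OPTIONS --safe #-}

-- After applying g⁻¹, a generator W disjoint from the extension of S∞ is the graph of a
-- hermitian matrix B, and W meets the extension of S_A exactly when A - B is singular.
-- Suppose A - B is regular for all A in U. Determinants of regular hermitian matrices lie in
-- 𝔽_q*, so f(A) = det (A - B) ^ (q - 1) - det A ^ (q - 1) is the indicator function of 0 on U.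
-- Let q = p ^ e, so that U ≅ 𝔽ₚ ^ (e n). As q - 1 = (p - 1)(1 + p + ... + p ^ (e - 1)), each of
-- the two terms has 𝔽ₚ-degree at most e n (p - 1), and the top-degree parts cancel because
-- det (A - B) and det A have the same leading form. But the indicator function of 0 on 𝔽ₚ ^ d
-- has degree d (p - 1), as in the proof of the Chevalley-Warning theorem.

module Submission where

open import Defs
open import Level using (0ℓ)
open import Algebra.Bundles using (CommutativeRing; Monoid)
open import Algebra.Structures using (IsCommutativeMonoid)
open import Data.Empty using (⊥-elim)
open import Data.Fin as Fin using (Fin; zero; suc; toℕ; fromℕ; inject₁; punchOut; funToFin; finToFun; combine; remQuot)
import Data.Fin.Permutation as Perm
import Data.Fin.Properties as Finₚ
open import Data.Fin.Subset using (Subset; inside; outside; ∣_∣; ⊤)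
open import Data.Fin.Subset.Properties using (∣p∣≤n)
open import Data.Integer as ℤ using (ℤ; -[1+_]; 0ℤ; 1ℤ)
import Data.Integer.Properties as ℤₚ
open import Data.List using (List; []; _∷_; _++_; foldr; length; allFin; tabulate; map; upTo; cartesianProductWith)
open import Data.List.Properties using (foldr-++; length-tabulate; length-++; length-map; length-upTo)
open import Data.List.Membership.Propositional using (_∈_; _∉_)
open import Data.List.Membership.Propositional.Properties using (∈-cartesianProductWith⁺; ∈-cartesianProductWith⁻; ∈-upTo⁺)
import Data.List.Membership.DecPropositional as DecMembership
import Data.List.Membership.Setoid.Properties as Membership
open import Data.List.Relation.Unary.All using (All; []; _∷_)
open import Data.List.Relation.Unary.AllPairs using ([]; _∷_)
open import Data.List.Relation.Unary.Any using (here; index)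
open import Data.List.Relation.Unary.Unique.Propositional using (Unique)
open import Data.List.Relation.Unary.Unique.Propositional.Properties using (allFin⁺)
import Data.Maybe as Maybe
open import Data.Nat as ℕ using (ℕ; zero; suc)
open import Data.Nat.Base using (_!)
open import Data.Nat.Combinatorics using (_C_; nCk≡nC[n∸k]; nCk≡n!/k![n-k]!; k![n∸k]!∣n!; nCn≡1)
open import Data.Nat.Coprimality using (prime⇒coprime; coprime-Bézout)
import Data.Nat.Divisibility as ℕ
import Data.Nat.DivMod as ℕ
open import Data.Nat.GCD using (module Bézout)
open import Data.Nat.Primality using (Prime; euclidsLemma; prime⇒nonTrivial)
import Data.Nat.Properties as ℕₚ
open import Data.Product using (_×_; _,_; ∃; proj₁; proj₂)
open import Data.Sign as Sign using (Sign)
open import Data.Sum using (inj₁; inj₂)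
open import Data.Vec using ([]; _∷_)
open import Function using (_∘_; Inverse)
open import Function.Definitions using (Injective)
open import Relation.Binary using (IsEquivalence)
open import Relation.Binary.PropositionalEquality
  using (_≡_; _≢_; refl; sym; trans; cong; cong₂; subst; module ≡-Reasoning)
  renaming (setoid to ≡-setoid; isEquivalence to ≡-isEquivalence)
open import Relation.Nullary using (¬_; Dec; yes; no)
open import Relation.Nullary.Decidable using (map′; dec⇒maybe; ¬?; _×-dec_; decidable-stable)

-- The set U comes with its addition but without a basis over 𝔽ₚ, so degrees are measured by
-- iterated differences instead of polynomials. This pays twice. The Frobenius map commutes with
-- differences, so p-th powers keep the degree; and the indicator function is seen to have large
-- degree by applying p - 1 differences in each of e n independent directions and watching that its
-- value at 0 never becomes zero. The cancellation of the top-degree parts gains a single degree,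
-- and that is exactly the margin: the difference has degree strictly below e n (p - 1), the degree
-- of the indicator function. Neither term alone would do, since under the assumption the first is
-- constant on U and the second attains the full degree. Determinants live in the exterior algebra:
-- wedging with one row after another suits an induction on degrees, and pairing wedges with
-- contractions yields both the transpose rule and the link between regularity and a nonzero
-- determinant.

-- Ring identities with integer coefficients.

module IntegerCoefficients (R : CommutativeRing 0ℓ 0ℓ) where
  open CommutativeRing R renaming (refl to ≈-refl; sym to ≈-sym; trans to ≈-trans)
  open import Algebra.Properties.Semiring.Mult.TCOptimised semiring
    renaming (_×_ to _×′_)
  open import Algebra.Properties.Ring ring
  open import Algebra.Properties.AbelianGroup +-abelianGroup using (⁻¹-∙-comm; ε⁻¹≈ε; ⁻¹-involutive)
  open import Algebra.Solver.Ring.AlmostCommutativeRing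
  open import Relation.Binary.Reasoning.Setoid setoid

  private
    ⟦_⟧ : ℤ → Carrier
    ⟦ ℤ.+ n ⟧      = n ×′ 1#
    ⟦ -[1+ n ] ⟧ = - (suc n ×′ 1#)

    -- Mixed signs are the only substantial case of additivity: `_⊖_` strips a successor from both
    -- sides, which is matched here by inserting 1 - 1.
    ⟦⊖⟧ : ∀ m n → ⟦ m ℤ.⊖ n ⟧ ≈ m ×′ 1# + - (n ×′ 1#)
    ⟦⊖⟧ m       zero    = ≈-sym (≈-trans (+-congˡ ε⁻¹≈ε) (+-identityʳ _))
    ⟦⊖⟧ zero    (suc n) = ≈-sym (+-identityˡ _)
    ⟦⊖⟧ (suc m) (suc n) = begin
      ⟦ suc m ℤ.⊖ suc n ⟧            ≡⟨ cong ⟦_⟧ (ℤₚ.[1+m]⊖[1+n]≡m⊖n m n) ⟩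
      ⟦ m ℤ.⊖ n ⟧                    ≈⟨ ⟦⊖⟧ m n ⟩
      a + - b                      ≈⟨ +-congʳ (+-identityʳ a) ⟨
      (a + 0#) + - b               ≈⟨ +-congʳ (+-congˡ (-‿inverseʳ 1#)) ⟨
      (a + (1# + - 1#)) + - b      ≈⟨ +-congʳ (+-assoc _ _ _) ⟨
      ((a + 1#) + - 1#) + - b      ≈⟨ +-assoc _ _ _ ⟩
      (a + 1#) + (- 1# + - b)      ≈⟨ +-cong (+-comm _ _) (⁻¹-∙-comm _ _) ⟩
      (1# + a) + - (1# + b)        ≈⟨ +-cong (1+× m 1#) (-‿cong (1+× n 1#)) ⟨
      suc m ×′ 1# + - (suc n ×′ 1#) ∎
      where
      a = m ×′ 1#
      b = n ×′ 1#

    +-homo : ∀ i j → ⟦ i ℤ.+ j ⟧ ≈ ⟦ i ⟧ + ⟦ j ⟧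
    +-homo (ℤ.+ m)    (ℤ.+ n)    = ×-homo-+ 1# m n
    +-homo (ℤ.+ m)    -[1+ n ] = ⟦⊖⟧ m (suc n)
    +-homo -[1+ m ] (ℤ.+ n)    = ≈-trans (⟦⊖⟧ n (suc m)) (+-comm _ _)
    +-homo -[1+ m ] -[1+ n ] = begin
      - (suc (suc (m ℕ.+ n)) ×′ 1#)         ≡⟨ cong (λ k → - (suc k ×′ 1#)) (ℕₚ.+-suc m n) ⟨
      - ((suc m ℕ.+ suc n) ×′ 1#)           ≈⟨ -‿cong (×-homo-+ 1# (suc m) (suc n)) ⟩
      - (suc m ×′ 1# + suc n ×′ 1#)         ≈⟨ ⁻¹-∙-comm _ _ ⟨
      - (suc m ×′ 1#) + - (suc n ×′ 1#)     ∎

    ⟦-◃⟧ : ∀ n → ⟦ Sign.- ℤ.◃ n ⟧ ≈ - (n ×′ 1#)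
    ⟦-◃⟧ zero    = ≈-sym ε⁻¹≈ε
    ⟦-◃⟧ (suc n) = ≈-refl

    ⟦+◃⟧ : ∀ n → ⟦ Sign.+ ℤ.◃ n ⟧ ≈ n ×′ 1#
    ⟦+◃⟧ zero    = ≈-refl
    ⟦+◃⟧ (suc n) = ≈-refl

    *-homo : ∀ i j → ⟦ i ℤ.* j ⟧ ≈ ⟦ i ⟧ * ⟦ j ⟧
    *-homo (ℤ.+ m)    (ℤ.+ n)    = ≈-trans (⟦+◃⟧ (m ℕ.* n)) (×1-homo-* m n)
    *-homo (ℤ.+ m)    -[1+ n ] = begin
      ⟦ Sign.- ℤ.◃ m ℕ.* suc n ⟧       ≈⟨ ⟦-◃⟧ (m ℕ.* suc n) ⟩
      - ((m ℕ.* suc n) ×′ 1#)        ≈⟨ -‿cong (×1-homo-* m (suc n)) ⟩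
      - (m ×′ 1# * (suc n ×′ 1#))    ≈⟨ -‿distribʳ-* _ _ ⟩
      m ×′ 1# * - (suc n ×′ 1#)      ∎
    *-homo -[1+ m ] (ℤ.+ n)    = begin
      ⟦ Sign.- ℤ.◃ suc m ℕ.* n ⟧       ≈⟨ ⟦-◃⟧ (suc m ℕ.* n) ⟩
      - ((suc m ℕ.* n) ×′ 1#)        ≈⟨ -‿cong (×1-homo-* (suc m) n) ⟩
      - (suc m ×′ 1# * (n ×′ 1#))    ≈⟨ -‿distribˡ-* _ _ ⟩
      - (suc m ×′ 1#) * (n ×′ 1#)    ∎
    *-homo -[1+ m ] -[1+ n ] = begin
      (suc m ℕ.* suc n) ×′ 1#                ≈⟨ ×1-homo-* (suc m) (suc n) ⟩
      suc m ×′ 1# * (suc n ×′ 1#)            ≈⟨ ⁻¹-involutive _ ⟨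
      - - (suc m ×′ 1# * (suc n ×′ 1#))      ≈⟨ -‿cong (-‿distribˡ-* _ _) ⟩
      - (- (suc m ×′ 1#) * (suc n ×′ 1#))    ≈⟨ -‿distribʳ-* _ _ ⟩
      - (suc m ×′ 1#) * - (suc n ×′ 1#)      ∎

    -‿homo : ∀ i → ⟦ ℤ.- i ⟧ ≈ - ⟦ i ⟧
    -‿homo (ℤ.+ zero)  = ≈-sym ε⁻¹≈ε
    -‿homo (ℤ.+ suc n) = ≈-refl
    -‿homo -[1+ n ]  = ≈-sym (⁻¹-involutive _)

    homomorphism : ℤ.+-*-rawRing -Raw-AlmostCommutative⟶ fromCommutativeRing R
    homomorphism = record
      { ⟦_⟧ = ⟦_⟧ ; +-homo = +-homo ; *-homo = *-homo ; -‿homo = -‿homo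
      ; 0-homo = ≈-refl ; 1-homo = ≈-refl }

  -- Coefficients are compared in ℤ, where equality is decided by computation, so normal forms can
  -- cancel although the carrier is abstract.
  open import Algebra.Solver.Ring ℤ.+-*-rawRing (fromCommutativeRing R) homomorphism
    (λ i j → Maybe.map (reflexive ∘ cong ⟦_⟧) (dec⇒maybe (i ℤ.≟ j))) public
    using (solve; _:=_; _:+_; _:*_; :-_; con)

-- Arithmetic and characteristic of a finite field.

module FieldProperties (K : FiniteField) where
  open FiniteField K
  commutativeRing : CommutativeRing 0ℓ 0ℓ
  commutativeRing = record { isCommutativeRing = isCommutativeRing }
  open CommutativeRing commutativeRing public
    using (+-assoc; +-comm; +-identityˡ; +-identityʳ; *-assoc; *-comm; *-identityˡ;
           *-identityʳ; zeroˡ; zeroʳ; distribˡ; distribʳ; -‿inverseʳ;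
           semiring; commutativeSemiring; +-commutativeMonoid)
  open IntegerCoefficients commutativeRing public
  open import Algebra.Properties.Semiring.Exp semiring public using (_^_; ^-assocʳ)
  open import Algebra.Properties.CommutativeSemiring.Exp commutativeSemiring public
    using (^-distrib-*)
  open import Algebra.Properties.Semiring.Mult semiring public
    using (×1-homo-*; ×-assoc-*; ×-assocˡ; ×-homo-1) renaming (_×_ to _ℕ×_)
  open import Algebra.Properties.Semiring.Sum semiring
    using (sum; sum-replicate; sum-cong-≗)
  open import Algebra.Properties.CommutativeMonoid.Sum +-commutativeMonoid
    using (sum-permute; ∑-distrib-+)
  open Inverse enum using (to; from; strictlyInverseˡ; strictlyInverseʳ)
  open ≡-Reasoning

  _≟_ : (x y : Carrier) → Dec (x ≡ y)
  x ≟ y = map′ (λ e → trans (sym (strictlyInverseʳ x)) (trans (cong from e) (strictlyInverseʳ y)))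
               (cong to) (to x Fin.≟ to y)

  *-cancelˡ : ∀ {x y z} → x ≢ 0# → x * y ≡ x * z → y ≡ z
  *-cancelˡ {x} {y} {z} x≢0 xy≡xz = begin
    y               ≡⟨ expand y ⟩
    x⁻¹ * (x * y)   ≡⟨ cong (x⁻¹ *_) xy≡xz ⟩
    x⁻¹ * (x * z)   ≡⟨ expand z ⟨
    z               ∎
    where
    x⁻¹ = proj₁ (inverse x x≢0)
    expand : ∀ w → w ≡ x⁻¹ * (x * w)
    expand w = begin
      w               ≡⟨ *-identityˡ w ⟨
      1# * w          ≡⟨ cong (_* w) (proj₂ (inverse x x≢0)) ⟨
      (x * x⁻¹) * w   ≡⟨ cong (_* w) (*-comm x x⁻¹) ⟩
      (x⁻¹ * x) * w   ≡⟨ *-assoc x⁻¹ x w ⟩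
      x⁻¹ * (x * w)   ∎

  x*y≡0⇒y≡0 : ∀ {x y} → x ≢ 0# → x * y ≡ 0# → y ≡ 0#
  x*y≡0⇒y≡0 {x} x≢0 xy≡0 = *-cancelˡ x≢0 (trans xy≡0 (sym (zeroʳ x)))

  x^n≡0⇒x≡0 : ∀ {x} n → x ^ n ≡ 0# → x ≡ 0#
  x^n≡0⇒x≡0 zero    1≡0 = ⊥-elim (0≢1 (sym 1≡0))
  x^n≡0⇒x≡0 {x} (suc n) e with x ≟ 0#
  ... | yes x≡0 = x≡0
  ... | no  x≢0 = x^n≡0⇒x≡0 n (x*y≡0⇒y≡0 x≢0 e)

  -- Translation by 1 permutes K, so it does not change the sum of all elements.
  size×1≡0 : size ℕ× 1# ≡ 0#
  size×1≡0 = begin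
    size ℕ× 1#
      ≡⟨ solve 2 (λ s t → t := (s :+ t) :+ :- s) refl S (size ℕ× 1#) ⟩
    (S + size ℕ× 1#) + - S           ≡⟨ cong (λ t → (S + t) + - S) (sum-replicate size) ⟨
    (S + sum {size} (λ _ → 1#)) + - S ≡⟨ cong (_+ - S) (∑-distrib-+ from (λ _ → 1#)) ⟨
    sum {size} (λ i → from i + 1#) + - S
      ≡⟨ cong (_+ - S) (sum-cong-≗ (λ i → strictlyInverseʳ (from i + 1#))) ⟨
    sum {size} (λ i → from (shift i)) + - S ≡⟨ cong (_+ - S) (sum-permute from π) ⟨
    S + - S                          ≡⟨ -‿inverseʳ S ⟩
    0#                               ∎
    where
    S = sum {size} from
    shift shift⁻¹ : Fin size → Fin size
    shift   i = to (from i + 1#)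
    shift⁻¹ i = to (from i + - 1#)
    shift∘shift⁻¹ : ∀ i → shift (shift⁻¹ i) ≡ i
    shift∘shift⁻¹ i = begin
      to (from (to (from i + - 1#)) + 1#)  ≡⟨ cong (λ t → to (t + 1#)) (strictlyInverseʳ _) ⟩
      to ((from i + - 1#) + 1#)
        ≡⟨ cong to (solve 1 (λ x → (x :+ :- con 1ℤ) :+ con 1ℤ := x) refl (from i)) ⟩
      to (from i)                          ≡⟨ strictlyInverseˡ i ⟩
      i                                    ∎
    shift⁻¹∘shift : ∀ i → shift⁻¹ (shift i) ≡ i
    shift⁻¹∘shift i = begin
      to (from (to (from i + 1#)) + - 1#)  ≡⟨ cong (λ t → to (t + - 1#)) (strictlyInverseʳ _) ⟩
      to ((from i + 1#) + - 1#)
        ≡⟨ cong to (solve 1 (λ x → (x :+ con 1ℤ) :+ :- con 1ℤ := x) refl (from i)) ⟩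
      to (from i)                          ≡⟨ strictlyInverseˡ i ⟩
      i                                    ∎
    π : Perm.Permutation size size
    π = Perm.permutation shift shift⁻¹ shift∘shift⁻¹ shift⁻¹∘shift

  ^ℕ×1 : ∀ m n → (m ℕ.^ n) ℕ× 1# ≡ (m ℕ× 1#) ^ n
  ^ℕ×1 m zero    = +-identityʳ 1#
  ^ℕ×1 m (suc n) = trans (×1-homo-* m (m ℕ.^ n)) (cong ((m ℕ× 1#) *_) (^ℕ×1 m n))

  -- By `size×1≡0` the element p · 1 is nilpotent, and a field has no nonzero nilpotent elements.
  characteristic : ∀ p m → size ≡ p ℕ.^ m → p ℕ× 1# ≡ 0#
  characteristic p m size≡ = x^n≡0⇒x≡0 m (begin
    (p ℕ× 1#) ^ m     ≡⟨ ^ℕ×1 p m ⟨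
    (p ℕ.^ m) ℕ× 1#   ≡⟨ cong (_ℕ× 1#) size≡ ⟨
    size ℕ× 1#        ≡⟨ size×1≡0 ⟩
    0#                ∎)

HasCharacteristic : FiniteField → ℕ → Set
HasCharacteristic K p = p ℕ× 1# ≡ 0#
  where
  open FiniteField K
  open FieldProperties K

-- Binomial coefficients modulo p and the Frobenius map.

prime∤! : ∀ {p} → Prime p → ∀ m → m ℕ.< p → ¬ p ℕ.∣ m !
prime∤! pp zero    m<p p∣m! = ℕ.nonTrivial⇒≢1 {{prime⇒nonTrivial pp}} (ℕ.∣1⇒≡1 p∣m!)
prime∤! pp (suc m) m<p p∣m! with euclidsLemma (suc m) (m !) pp p∣m!
... | inj₁ p∣1+m = ℕ.>⇒∤ m<p p∣1+m
... | inj₂ p∣m!′ = prime∤! pp m (ℕₚ.<-trans (ℕₚ.n<1+n m) m<p) p∣m!′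

-- The prime p divides p! = (p C k) k! (p - k)!, but all factors of k! and (p - k)! are smaller than
-- p.
prime∣C : ∀ {p} → Prime p → ∀ {k} → 0 ℕ.< k → k ℕ.< p → p ℕ.∣ p C k
prime∣C {p@(suc p-1)} pp {k} 0<k k<p
  with euclidsLemma (p C k) _ pp (subst (p ℕ.∣_) (sym C*k![p-k]!≡p!) (ℕ.m∣m*n (p-1 !)))
    where
    instance _ = ℕₚ.m*n≢0 (k !) ((p ℕ.∸ k) !) {{k ℕₚ.!≢0}} {{(p ℕ.∸ k) ℕₚ.!≢0}}
    C*k![p-k]!≡p! : (p C k) ℕ.* (k ! ℕ.* (p ℕ.∸ k) !) ≡ p !
    C*k![p-k]!≡p! = trans (cong (ℕ._* (k ! ℕ.* (p ℕ.∸ k) !)) (nCk≡n!/k![n-k]! (ℕₚ.<⇒≤ k<p)))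
                          (ℕ.m/n*n≡m (k![n∸k]!∣n! (ℕₚ.<⇒≤ k<p)))
... | inj₁ p∣C = p∣C
... | inj₂ p∣k![p-k]! with euclidsLemma (k !) _ pp p∣k![p-k]!
...   | inj₁ p∣k!     = ⊥-elim (prime∤! pp k k<p p∣k!)
...   | inj₂ p∣[p-k]! = ⊥-elim (prime∤! pp (p ℕ.∸ k) (ℕₚ.∸-monoʳ-< {p} 0<k (ℕₚ.<⇒≤ k<p)) p∣[p-k]!)

module Frobenius (K : FiniteField) (p-1 : ℕ) (p-prime : Prime (suc p-1))
  (char-p : HasCharacteristic K (suc p-1)) where
  private
    p = suc p-1

  open FiniteField K
  open FieldProperties K
  open import Algebra.Properties.CommutativeSemiring.Binomial commutativeSemiring
    using (binomialTerm; theorem)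
  open import Algebra.Properties.Semiring.Sum semiring
    using (sum; sum-replicate-zero; sum-init-last; sum-cong-≗)
  open ≡-Reasoning

  p∣n⇒n×x≡0 : ∀ {n} → p ℕ.∣ n → ∀ x → n ℕ× x ≡ 0#
  p∣n⇒n×x≡0 (ℕ.divides r refl) x = begin
    (r ℕ.* p) ℕ× x              ≡⟨ cong ((r ℕ.* p) ℕ×_) (*-identityˡ x) ⟨
    (r ℕ.* p) ℕ× (1# * x)       ≡⟨ ×-assoc-* (r ℕ.* p) 1# x ⟨
    ((r ℕ.* p) ℕ× 1#) * x       ≡⟨ cong (_* x) (×1-homo-* r p) ⟩
    ((r ℕ× 1#) * (p ℕ× 1#)) * x ≡⟨ cong (λ t → ((r ℕ× 1#) * t) * x) char-p ⟩
    ((r ℕ× 1#) * 0#) * x        ≡⟨ cong (_* x) (zeroʳ _) ⟩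
    0# * x                      ≡⟨ zeroˡ x ⟩
    0#                          ∎

  -- In the binomial theorem only the two outer terms survive; the middle indices are i + 1 with i <
  -- p - 1, so their coefficients are divisible by p.
  ^p-homo-+ : ∀ x y → (x + y) ^ p ≡ x ^ p + y ^ p
  ^p-homo-+ x y = begin
    (x + y) ^ p                              ≡⟨ theorem p x y ⟩
    t zero + sum (λ i → t (suc i))           ≡⟨ cong (t zero +_) (sum-init-last (λ i → t (suc i))) ⟩
    t zero + (sum (λ i → t (suc (inject₁ i))) + t (suc (fromℕ p-1)))
      ≡⟨ cong₂ (λ u v → t zero + (u + v)) (trans (sum-cong-≗ middle) (sum-replicate-zero p-1))
          last ⟩
    t zero + (0# + x ^ p)                    ≡⟨ cong₂ _+_ first (+-identityˡ (x ^ p)) ⟩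
    y ^ p + x ^ p                            ≡⟨ +-comm _ _ ⟩
    x ^ p + y ^ p                            ∎
    where
    t : Fin (suc p) → Carrier
    t = binomialTerm x y p
    middle : ∀ i → t (suc (inject₁ i)) ≡ 0#
    middle i = p∣n⇒n×x≡0 (prime∣C p-prime (ℕ.s≤s ℕ.z≤n)
        (ℕ.s≤s (subst (ℕ._< p-1) (sym (Finₚ.toℕ-inject₁ i)) (Finₚ.toℕ<n i)))) _
    first : t zero ≡ y ^ p
    first = begin
      (p C 0) ℕ× (1# * y ^ p)
        ≡⟨ cong (_ℕ× (1# * y ^ p)) (trans (nCk≡nC[n∸k] {n = p} ℕ.z≤n) (nCn≡1 p)) ⟩
      1 ℕ× (1# * y ^ p)        ≡⟨ ×-homo-1 _ ⟩
      1# * y ^ p               ≡⟨ *-identityˡ _ ⟩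
      y ^ p                    ∎
    last : t (suc (fromℕ p-1)) ≡ x ^ p
    last = begin
      (p C suc (toℕ (fromℕ p-1))) ℕ× (x ^ suc (toℕ (fromℕ p-1)) * y ^ (p-1 ℕ.∸ toℕ (fromℕ p-1)))
        ≡⟨ cong (λ k → (p C suc k) ℕ× (x ^ suc k * y ^ (p-1 ℕ.∸ k))) (Finₚ.toℕ-fromℕ p-1) ⟩
      (p C p) ℕ× (x ^ p * y ^ (p-1 ℕ.∸ p-1))
        ≡⟨ cong₂ (λ c k → c ℕ× (x ^ p * y ^ k)) (nCn≡1 p) (ℕₚ.n∸n≡0 p-1) ⟩
      1 ℕ× (x ^ p * 1#)        ≡⟨ ×-homo-1 _ ⟩
      x ^ p * 1#               ≡⟨ *-identityʳ _ ⟩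
      x ^ p                    ∎

  ^p-0 : 0# ^ p ≡ 0#
  ^p-0 = zeroˡ _

  -- Derived from additivity and not from the sign of (-1) ^ p, which treats p = 2 and odd p alike.
  ^p-homo-neg : ∀ x → (- x) ^ p ≡ - (x ^ p)
  ^p-homo-neg x = begin
    (- x) ^ p
      ≡⟨ solve 2 (λ a b → a := (b :+ a) :+ :- b) refl _ (x ^ p) ⟩
    (x ^ p + (- x) ^ p) + - (x ^ p)        ≡⟨ cong (_+ - (x ^ p)) (^p-homo-+ x (- x)) ⟨
    (x + - x) ^ p + - (x ^ p)              ≡⟨ cong (λ z → z ^ p + - (x ^ p)) (-‿inverseʳ x) ⟩
    0# ^ p + - (x ^ p)                     ≡⟨ cong (_+ - (x ^ p)) ^p-0 ⟩
    0# + - (x ^ p)                         ≡⟨ +-identityˡ _ ⟩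
    - (x ^ p)                              ∎

  record IsEndomorphism (σ : Carrier → Carrier) : Set where
    field
      +-homo : ∀ x y → σ (x + y) ≡ σ x + σ y
      *-homo : ∀ x y → σ (x * y) ≡ σ x * σ y
      neg-homo : ∀ x → σ (- x) ≡ - σ x
      0-homo : σ 0# ≡ 0#
      1-homo : σ 1# ≡ 1#

  1^n : ∀ n → 1# ^ n ≡ 1#
  1^n zero    = refl
  1^n (suc n) = trans (*-identityˡ _) (1^n n)

  ^p^e-isEndomorphism : ∀ e → IsEndomorphism (_^ (p ℕ.^ e))
  ^p^e-isEndomorphism zero = record
    { +-homo = λ x y → solve 2 (λ x y → (x :+ y) :* con 1ℤ := x :* con 1ℤ :+ y :* con 1ℤ) refl x y
    ; *-homo = λ x y → solve 2 (λ x y → (x :* y) :* con 1ℤ := (x :* con 1ℤ) :* (y :* con 1ℤ)) refl x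
        y
    ; neg-homo = λ x → solve 1 (λ x → (:- x) :* con 1ℤ := :- (x :* con 1ℤ)) refl x
    ; 0-homo = zeroˡ _
    ; 1-homo = *-identityˡ _
    }
  ^p^e-isEndomorphism (suc e) = record
    { +-homo = λ x y → trans (split (x + y))
        (trans (cong (_^ q) (^p-homo-+ x y))
        (trans (+-homo _ _) (cong₂ _+_ (sym (split x)) (sym (split y)))))
    ; *-homo = λ x y → ^-distrib-* x y (p ℕ.^ suc e)
    ; neg-homo = λ x → trans (split (- x))
        (trans (cong (_^ q) (^p-homo-neg x)) (trans (neg-homo _) (cong -_ (sym (split x)))))
    ; 0-homo = trans (split 0#) (trans (cong (_^ q) ^p-0) 0-homo)
    ; 1-homo = 1^n (p ℕ.^ suc e)
    }
    where
    q = p ℕ.^ e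
    open IsEndomorphism (^p^e-isEndomorphism e)
    split : ∀ x → x ^ (p ℕ.* q) ≡ (x ^ p) ^ q
    split x = sym (^-assocʳ x p q)

  -- x ^ (p ^ e - 1), factored so that its 𝔽ₚ-degree e * (p - 1) is visible.
  unitPower : ℕ → Carrier → Carrier
  unitPower zero    x = 1#
  unitPower (suc e) x = x ^ p-1 * unitPower e x ^ p

  -- The recursion mirrors p ^ (e + 1) - 1 = (p - 1) + p (p ^ e - 1). The extra factor x removes the
  -- subtraction from the exponent.
  x*unitPower : ∀ e x → x * unitPower e x ≡ x ^ (p ℕ.^ e)
  x*unitPower zero    x = refl
  x*unitPower (suc e) x = begin
    x * (x ^ p-1 * unitPower e x ^ p)   ≡⟨ *-assoc _ _ _ ⟨
    x ^ p * unitPower e x ^ p           ≡⟨ ^-distrib-* x (unitPower e x) p ⟨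
    (x * unitPower e x) ^ p             ≡⟨ cong (_^ p) (x*unitPower e x) ⟩
    (x ^ (p ℕ.^ e)) ^ p                 ≡⟨ ^-assocʳ x (p ℕ.^ e) p ⟩
    x ^ (p ℕ.^ e ℕ.* p)                 ≡⟨ cong (x ^_) (ℕₚ.*-comm (p ℕ.^ e) p) ⟩
    x ^ (p ℕ.* p ℕ.^ e)                 ∎

-- The exterior algebra and determinants.

module ExteriorAlgebra (K : FiniteField) (q : ℕ) where
  open FiniteField K
  open Geometry K q using (Σ; Vect; Mat; idM)
  open FieldProperties K
  open ≡-Reasoning

  infix 8 _•_
  _•_ : ∀ {n} → Vect n → Vect n → Carrier
  f • v = Σ _ (λ i → f i * v i)

  -- The exterior algebra of Kⁿ: the coefficient at s belongs to the wedge, in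
  -- increasing order, of the basis vectors selected by s.
  Λ : ℕ → Set
  Λ n = Subset n → Carrier

  one : ∀ {n} → Λ n
  one []          = 1#
  one (outside ∷ s) = one s
  one (inside ∷ s)  = 0#

  -- With x = a + e₀ ∧ b, wedge v x = v ∧ x and ι f x is the contraction of x by f.
  wedge : ∀ {n} → Vect n → Λ n → Λ n
  wedge v x []          = 0#
  wedge v x (outside ∷ s) = wedge (v ∘ suc) (x ∘ (outside ∷_)) s
  wedge v x (inside ∷ s)  = v zero * x (outside ∷ s) + - wedge (v ∘ suc) (x ∘ (inside ∷_)) s

  ι : ∀ {n} → Vect n → Λ n → Λ n
  ι f x []          = 0#
  ι f x (outside ∷ s) = ι (f ∘ suc) (x ∘ (outside ∷_)) s + f zero * x (inside ∷ s)
  ι f x (inside ∷ s)  = - ι (f ∘ suc) (x ∘ (inside ∷_)) s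

  -- The bilinear form for which the basis wedges are orthonormal. On wedges of vectors it is the
  -- determinant of their mutual scalar products.
  ⟪_,_⟫ : ∀ {n} → Λ n → Λ n → Carrier
  ⟪_,_⟫ {zero}  x y = x [] * y []
  ⟪_,_⟫ {suc n} x y = ⟪ x ∘ (outside ∷_) , y ∘ (outside ∷_) ⟫ +
      ⟪ x ∘ (inside ∷_) , y ∘ (inside ∷_) ⟫

  -- Stated for any `z` that agrees pointwise with a combination of two elements, so that
  -- congruence, vanishing and sign rules are the cases (c, d) = (1, 0), (0, 0), (-1, 0). The
  -- helpers `identical`, `vanishing` and `negated` translate to and from these cases.
  wedge-linear : ∀ {n} (v : Vect n) {x y z c d} → (∀ t → z t ≡ c * x t + d * y t) →
                 ∀ s → wedge v z s ≡ c * wedge v x s + d * wedge v y s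
  wedge-linear v {c = c} {d} z≡ [] = solve 2 (λ c d → con 0ℤ := c :* con 0ℤ :+ d :* con 0ℤ) refl c d
  wedge-linear v z≡ (outside ∷ s) = wedge-linear (v ∘ suc) (λ t → z≡ (outside ∷ t)) s
  wedge-linear v {x} {y} {z} {c} {d} z≡ (inside ∷ s) = begin
    v zero * z (outside ∷ s) + - wedge (v ∘ suc) (z ∘ (inside ∷_)) s
      ≡⟨ cong₂ (λ a b → v zero * a + - b) (z≡ (outside ∷ s))
          (wedge-linear (v ∘ suc) (λ t → z≡ (inside ∷ t)) s) ⟩
    v zero * (c * x (outside ∷ s) + d * y (outside ∷ s)) + - (c * X + d * Y)
      ≡⟨ solve 7 (λ v x y c d X Y → v :* (c :* x :+ d :* y) :+ :- (c :* X :+ d :* Y) :=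
                   c :* (v :* x :+ :- X) :+ d :* (v :* y :+ :- Y)) refl (v zero) _ _ c d X Y ⟩
    c * (v zero * x (outside ∷ s) + - X) + d * (v zero * y (outside ∷ s) + - Y)  ∎
    where
    X = wedge (v ∘ suc) (x ∘ (inside ∷_)) s
    Y = wedge (v ∘ suc) (y ∘ (inside ∷_)) s

  ι-linear : ∀ {n} (f : Vect n) {x y z c d} → (∀ t → z t ≡ c * x t + d * y t) →
             ∀ s → ι f z s ≡ c * ι f x s + d * ι f y s
  ι-linear f {c = c} {d} z≡ [] = solve 2 (λ c d → con 0ℤ := c :* con 0ℤ :+ d :* con 0ℤ) refl c d
  ι-linear f {x} {y} {z} {c} {d} z≡ (outside ∷ s) = begin
    ι (f ∘ suc) (z ∘ (outside ∷_)) s + f zero * z (inside ∷ s)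
      ≡⟨ cong₂ (λ a b → b + f zero * a) (z≡ (inside ∷ s))
          (ι-linear (f ∘ suc) (λ t → z≡ (outside ∷ t)) s) ⟩
    (c * X + d * Y) + f zero * (c * x (inside ∷ s) + d * y (inside ∷ s))
      ≡⟨ solve 7 (λ v x y c d X Y → (c :* X :+ d :* Y) :+ v :* (c :* x :+ d :* y) :=
                   c :* (X :+ v :* x) :+ d :* (Y :+ v :* y)) refl (f zero) _ _ c d X Y ⟩
    c * (X + f zero * x (inside ∷ s)) + d * (Y + f zero * y (inside ∷ s))  ∎
    where
    X = ι (f ∘ suc) (x ∘ (outside ∷_)) s
    Y = ι (f ∘ suc) (y ∘ (outside ∷_)) s
  ι-linear f {c = c} {d} z≡ (inside ∷ s) =
      trans (cong -_ (ι-linear (f ∘ suc) (λ t → z≡ (inside ∷ t)) s))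
    (solve 4 (λ c d X Y → :- (c :* X :+ d :* Y) := c :* (:- X) :+ d :* (:- Y)) refl c d _ _)

  ⟪⟫-comm : ∀ {n} (x y : Λ n) → ⟪ x , y ⟫ ≡ ⟪ y , x ⟫
  ⟪⟫-comm {zero}  x y = *-comm _ _
  ⟪⟫-comm {suc n} x y = cong₂ _+_ (⟪⟫-comm {n} _ _) (⟪⟫-comm {n} _ _)

  ⟪⟫-linearʳ : ∀ {n} (w : Λ n) {x y z c d} → (∀ t → z t ≡ c * x t + d * y t) →
               ⟪ w , z ⟫ ≡ c * ⟪ w , x ⟫ + d * ⟪ w , y ⟫
  ⟪⟫-linearʳ {zero} w {c = c} {d} z≡ = trans (cong (w [] *_) (z≡ []))
    (solve 5 (λ w c d x y → w :* (c :* x :+ d :* y) := c :* (w :* x) :+ d :* (w :* y)) refl (w []) c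
        d _ _)
  ⟪⟫-linearʳ {suc n} w {c = c} {d} z≡ = trans
    (cong₂ _+_ (⟪⟫-linearʳ {n} _ (λ t → z≡ (outside ∷ t)))
        (⟪⟫-linearʳ {n} _ (λ t → z≡ (inside ∷ t))))
    (solve 6 (λ c d x y x′ y′ → (c :* x :+ d :* y) :+ (c :* x′ :+ d :* y′) :=
       c :* (x :+ x′) :+ d :* (y :+ y′)) refl c d _ _ _ _)

  private
    identical : ∀ {x y} → x ≡ y → x ≡ 1# * y + 0# * 0#
    identical {y = y} e = trans e (solve 1 (λ y → y := con 1ℤ :* y :+ con 0ℤ :* con 0ℤ) refl y)

    identical⁻¹ : ∀ {x y z} → x ≡ 1# * y + 0# * z → x ≡ y
    identical⁻¹ {y = y} {z} e = trans e (solve 2 (λ y z → con 1ℤ :* y :+ con 0ℤ :* z := y) refl y z)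

    vanishing : ∀ {x} → x ≡ 0# → x ≡ 0# * 0# + 0# * 0#
    vanishing e = trans e (solve 0 (con 0ℤ := con 0ℤ :* con 0ℤ :+ con 0ℤ :* con 0ℤ) refl)

    vanishing⁻¹ : ∀ {x y z} → x ≡ 0# * y + 0# * z → x ≡ 0#
    vanishing⁻¹ {y = y} {z} e = trans e (solve 2 (λ y z → con 0ℤ :* y :+ con 0ℤ :* z := con 0ℤ) refl
        y z)

    negated : ∀ {x y} → x ≡ - y → x ≡ - 1# * y + 0# * 0#
    negated {y = y} e = trans e (solve 1 (λ y → :- y := :- con 1ℤ :* y :+ con 0ℤ :* con 0ℤ) refl y)

    negated⁻¹ : ∀ {x y z} → x ≡ - 1# * y + 0# * z → x ≡ - y
    negated⁻¹ {y = y} {z} e = trans e (solve 2 (λ y z → :- con 1ℤ :* y :+ con 0ℤ :* z := :- y) refl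
        y z)

    0Λ : ∀ {n} → Λ n
    0Λ _ = 0#

  wedge-zero : ∀ {n} (v : Vect n) {x} → (∀ t → x t ≡ 0#) → ∀ s → wedge v x s ≡ 0#
  wedge-zero v x≡0 s = vanishing⁻¹ (wedge-linear v {0Λ} {0Λ} (λ t → vanishing (x≡0 t)) s)

  wedge-neg : ∀ {n} (v : Vect n) x s → wedge v (λ t → - x t) s ≡ - wedge v x s
  wedge-neg v x s = negated⁻¹ (wedge-linear v {y = 0Λ} (λ t → negated refl) s)

  ⟪⟫-congʳ : ∀ {n} (w : Λ n) {x y} → (∀ t → x t ≡ y t) → ⟪ w , x ⟫ ≡ ⟪ w , y ⟫
  ⟪⟫-congʳ w x≡y = identical⁻¹ (⟪⟫-linearʳ w {y = 0Λ} (λ t → identical (x≡y t)))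

  ⟪⟫-zeroʳ : ∀ {n} (w : Λ n) {x} → (∀ t → x t ≡ 0#) → ⟪ w , x ⟫ ≡ 0#
  ⟪⟫-zeroʳ w x≡0 = vanishing⁻¹ (⟪⟫-linearʳ w {0Λ} {0Λ} (λ t → vanishing (x≡0 t)))

  ⟪⟫-negʳ : ∀ {n} (w x : Λ n) → ⟪ w , (λ t → - x t) ⟫ ≡ - ⟪ w , x ⟫
  ⟪⟫-negʳ w x = negated⁻¹ (⟪⟫-linearʳ w {y = 0Λ} (λ t → negated refl))

  -- Contraction is an antiderivation. Together with adjointness this relation drives all
  -- determinant identities below, in place of sums over permutations.
  clifford : ∀ {n} (f v : Vect n) x s → ι f (wedge v x) s ≡ (f • v) * x s + - wedge v (ι f x) s
  clifford f v x [] = solve 1 (λ y → con 0ℤ := con 0ℤ :* y :+ :- con 0ℤ) refl (x [])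
  clifford f v x (outside ∷ s) = begin
    ι f′ (wedge v′ a) s + f zero * (v zero * a s + - wedge v′ b s)
      ≡⟨ cong (_+ f zero * (v zero * a s + - wedge v′ b s)) (clifford f′ v′ a s) ⟩
    (f′ • v′ * a s + - wedge v′ (ι f′ a) s) + f zero * (v zero * a s + - wedge v′ b s)
      ≡⟨ solve 6 (λ d A I f v B → (d :* A :+ :- I) :+ f :* (v :* A :+ :- B) :=
           (f :* v :+ d) :* A :+ :- (con 1ℤ :* I :+ f :* B)) refl (f′ • v′) (a s) _ (f zero)
               (v zero) _ ⟩
    (f • v) * a s + - (1# * wedge v′ (ι f′ a) s + f zero * wedge v′ b s)
      ≡⟨ cong (λ t → (f • v) * a s + - t)
          (wedge-linear v′ (λ t → cong (_+ f zero * b t) (sym (*-identityˡ (ι f′ a t)))) s) ⟨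
    (f • v) * a s + - wedge v′ (λ t → ι f′ a t + f zero * b t) s ∎
    where
    f′ = f ∘ suc
    v′ = v ∘ suc
    a = x ∘ (outside ∷_)
    b = x ∘ (inside ∷_)
  clifford f v x (inside ∷ s) = begin
    - ι f′ (λ t → v zero * a t + - wedge v′ b t) s
      ≡⟨ cong -_ (ι-linear f′ (λ t → solve 3 (λ v A B → v :* A :+ :- B := v :* A :+ :- con 1ℤ :* B)
          refl (v zero) (a t) (wedge v′ b t)) s) ⟩
    - (v zero * ι f′ a s + - 1# * ι f′ (wedge v′ b) s)
      ≡⟨ cong (λ t → - (v zero * ι f′ a s + - 1# * t)) (clifford f′ v′ b s) ⟩
    - (v zero * ι f′ a s + - 1# * (f′ • v′ * b s + - wedge v′ (ι f′ b) s))
      ≡⟨ solve 6 (λ v A d B I f → :- (v :* A :+ :- con 1ℤ :* (d :* B :+ :- I)) :=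
           (f :* v :+ d) :* B :+ :- (v :* (A :+ f :* B) :+ :- (:- I))) refl (v zero) (ι f′ a s)
               (f′ • v′) (b s) _ (f zero) ⟩
    (f • v) * b s + - (v zero * (ι f′ a s + f zero * b s) + - (- wedge v′ (ι f′ b) s))
      ≡⟨ cong (λ t → (f • v) * b s + - (v zero * (ι f′ a s + f zero * b s) + - t))
          (wedge-neg v′ (ι f′ b) s) ⟨
    (f • v) * b s + - (v zero * (ι f′ a s + f zero * b s) + - wedge v′ (λ t → - ι f′ b t) s) ∎
    where
    f′ = f ∘ suc
    v′ = v ∘ suc
    a = x ∘ (outside ∷_)
    b = x ∘ (inside ∷_)

  -- Moves a factor from one side of the pairing to the other, where it acts as a contraction that
  -- `clifford` can evaluate.
  wedge-adjoint : ∀ {n} (f : Vect n) (x y : Λ n) → ⟪ wedge f x , y ⟫ ≡ ⟪ x , ι f y ⟫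
  wedge-adjoint {zero} f x y = solve 2 (λ x y → con 0ℤ :* y := x :* con 0ℤ) refl (x []) (y [])
  wedge-adjoint {suc n} f x y = begin
    ⟪ wedge f′ a , c ⟫ + ⟪ (λ t → f zero * a t + - wedge f′ b t) , d ⟫
      ≡⟨ cong₂ _+_ (wedge-adjoint f′ a c) (⟪⟫-comm _ d) ⟩
    ⟪ a , ι f′ c ⟫ + ⟪ d , (λ t → f zero * a t + - wedge f′ b t) ⟫
      ≡⟨ cong (⟪ a , ι f′ c ⟫ +_) (⟪⟫-linearʳ d
          (λ t → solve 3 (λ v A B → v :* A :+ :- B := v :* A :+ :- con 1ℤ :* B) refl (f zero) (a t)
          (wedge f′ b t))) ⟩
    ⟪ a , ι f′ c ⟫ + (f zero * ⟪ d , a ⟫ + - 1# * ⟪ d , wedge f′ b ⟫)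
      ≡⟨ cong₂ (λ r s → ⟪ a , ι f′ c ⟫ + (f zero * r + - 1# * s)) (⟪⟫-comm d a)
          (trans (⟪⟫-comm d _) (wedge-adjoint f′ b d)) ⟩
    ⟪ a , ι f′ c ⟫ + (f zero * ⟪ a , d ⟫ + - 1# * ⟪ b , ι f′ d ⟫)
      ≡⟨ solve 4 (λ I f J L → I :+ (f :* J :+ :- con 1ℤ :* L) := (con 1ℤ :* I :+ f :* J) :+ :- L)
          refl _ (f zero) _ _ ⟩
    (1# * ⟪ a , ι f′ c ⟫ + f zero * ⟪ a , d ⟫) + - ⟪ b , ι f′ d ⟫
      ≡⟨ cong₂ _+_ (⟪⟫-linearʳ a (λ t → cong (_+ f zero * d t) (sym (*-identityˡ (ι f′ c t)))))
          (⟪⟫-negʳ b (ι f′ d)) ⟨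
    ⟪ a , (λ t → ι f′ c t + f zero * d t) ⟫ + ⟪ b , (λ t → - ι f′ d t) ⟫ ∎
    where
    f′ = f ∘ suc
    a = x ∘ (outside ∷_)
    b = x ∘ (inside ∷_)
    c = y ∘ (outside ∷_)
    d = y ∘ (inside ∷_)

  ι-one : ∀ {n} (f : Vect n) s → ι f one s ≡ 0#
  ι-one f []          = refl
  ι-one f (outside ∷ s) = trans (cong (_+ f zero * 0#) (ι-one (f ∘ suc) s))
      (solve 1 (λ f → con 0ℤ :+ f :* con 0ℤ := con 0ℤ) refl (f zero))
  ι-one f (inside ∷ s)  = trans (cong -_ (vanishing⁻¹
      (ι-linear (f ∘ suc) {0Λ} {0Λ} (λ t → vanishing refl) s))) (solve 0 (:- con 0ℤ := con 0ℤ) refl)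

  ⟪one,one⟫ : ∀ n → ⟪ one {n} , one ⟫ ≡ 1#
  ⟪one,one⟫ zero    = *-identityˡ 1#
  ⟪one,one⟫ (suc n) = trans (cong₂ _+_ (⟪one,one⟫ n) (⟪⟫-zeroʳ {n} 0Λ (λ _ → refl)))
      (+-identityʳ 1#)

  wedges : ∀ {n} {I : Set} → (I → Vect n) → List I → Λ n → Λ n
  wedges v l x = foldr (wedge ∘ v) x l

  W : ∀ {n} {I : Set} → (I → Vect n) → List I → Λ n
  W v l = wedges v l one

  wedges-linear : ∀ {n} {I : Set} (v : I → Vect n) l {x y z c d} → (∀ t → z t ≡ c * x t + d * y t) →
                  ∀ s → wedges v l z s ≡ c * wedges v l x s + d * wedges v l y s
  wedges-linear v []      z≡ = z≡
  wedges-linear v (i ∷ l) z≡ = wedge-linear (v i) (wedges-linear v l z≡)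

  module _ {m n : ℕ} {I J : Set} (f : J → Vect m) (v : I → Vect m) (g : J → Vect n) (w : I → Vect n)
           (f•v≡g•w : ∀ j i → f j • v i ≡ g j • w i) where

    -- Both sides are the determinant of the matrix of the f j • v i.
    gram-cong : ∀ k l → ⟪ W f k , W v l ⟫ ≡ ⟪ W g k , W w l ⟫

    private
      -- Laplace expansion along row `j`. The list `pre` holds the vectors that the contraction has
      -- already passed; at the next vector, `clifford` either evaluates the scalar product, leaving
      -- a minor with a shorter `k`, or moves that vector into `pre` at the cost of a sign.
      gram-expand : ∀ j k pre l → ⟪ W f k , wedges v pre (ι (f j) (W v l)) ⟫ ≡
                                  ⟪ W g k , wedges w pre (ι (g j) (W w l)) ⟫
      gram-expand j k pre [] = trans (zeros f v) (sym (zeros g w))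
        where
        zeros : ∀ {r} (f : J → Vect r) (v : I → Vect r) →
                ⟪ W f k , wedges v pre (ι (f j) one) ⟫ ≡ 0#
        zeros f v = ⟪⟫-zeroʳ (W f k) (λ s →
            vanishing⁻¹ (wedges-linear v pre {0Λ} {0Λ} (λ t → vanishing (ι-one (f j) t)) s))
      gram-expand j k pre (i ∷ l) = begin
        ⟪ W f k , wedges v pre (ι (f j) (W v (i ∷ l))) ⟫
          ≡⟨ expand f v ⟩
        (f j • v i) * ⟪ W f k , W v (pre ++ l) ⟫ + - 1# *
            ⟪ W f k , wedges v (pre ++ i ∷ []) (ι (f j) (W v l)) ⟫
          ≡⟨ cong₂ (λ a b → a + - 1# * b) (cong₂ _*_ (f•v≡g•w j i) (gram-cong k (pre ++ l)))
              (gram-expand j k (pre ++ i ∷ []) l) ⟩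
        (g j • w i) * ⟪ W g k , W w (pre ++ l) ⟫ + - 1# *
            ⟪ W g k , wedges w (pre ++ i ∷ []) (ι (g j) (W w l)) ⟫
          ≡⟨ expand g w ⟨
        ⟪ W g k , wedges w pre (ι (g j) (W w (i ∷ l))) ⟫ ∎
        where
        expand : ∀ {r} (f : J → Vect r) (v : I → Vect r) →
                 ⟪ W f k , wedges v pre (ι (f j) (W v (i ∷ l))) ⟫ ≡
                 (f j • v i) * ⟪ W f k , W v (pre ++ l) ⟫ + - 1# *
                     ⟪ W f k , wedges v (pre ++ i ∷ []) (ι (f j) (W v l)) ⟫
        expand f v = begin
          ⟪ W f k , wedges v pre (ι (f j) (W v (i ∷ l))) ⟫
            ≡⟨ ⟪⟫-linearʳ (W f k) (wedges-linear v pre (λ t → trans (clifford (f j) (v i) (W v l) t)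
                 (solve 2 (λ A B → A :+ :- B := A :+ :- con 1ℤ :* B) refl ((f j • v i) * W v l t)
                     (wedge (v i) (ι (f j) (W v l)) t)))) ⟩
          (f j • v i) * ⟪ W f k , wedges v pre (W v l) ⟫ + - 1# *
              ⟪ W f k , wedges v pre (wedge (v i) (ι (f j) (W v l))) ⟫
            ≡⟨ cong₂ (λ a b → (f j • v i) * ⟪ W f k , a ⟫ + - 1# * ⟪ W f k , b ⟫)
                 (foldr-++ (wedge ∘ v) one pre l) (foldr-++ (wedge ∘ v) _ pre (i ∷ [])) ⟨
          (f j • v i) * ⟪ W f k , W v (pre ++ l) ⟫ + - 1# *
              ⟪ W f k , wedges v (pre ++ i ∷ []) (ι (f j) (W v l)) ⟫ ∎

    gram-cong []      []      = trans (⟪one,one⟫ m) (sym (⟪one,one⟫ n))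
    gram-cong []      (i ∷ l) = trans (zeros v) (sym (zeros w))
      where
      zeros : ∀ {r} (v : I → Vect r) → ⟪ one , W v (i ∷ l) ⟫ ≡ 0#
      zeros {r} v = trans (⟪⟫-comm {r} one (W v (i ∷ l)))
          (trans (wedge-adjoint (v i) (W v l) one) (⟪⟫-zeroʳ (W v l) (ι-one (v i))))
    gram-cong (j ∷ k) l = trans (wedge-adjoint (f j) (W f k) (W v l))
      (trans (gram-expand j k [] l) (sym (wedge-adjoint (g j) (W g k) (W w l))))

  module _ {n : ℕ} {I : Set} (f v : I → Vect n)
           (f•v≡1 : ∀ i → f i • v i ≡ 1#) (f•v≡0 : ∀ {i j} → i ≢ j → f i • v j ≡ 0#) where

    ι-dual : ∀ {i} l → All (i ≢_) l → ∀ s → ι (f i) (W v l) s ≡ 0#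
    ι-dual {i} []      []           s = ι-one (f i) s
    ι-dual {i} (j ∷ l) (i≢j ∷ i∉l) s = begin
      ι (f i) (W v (j ∷ l)) s                            ≡⟨ clifford (f i) (v j) (W v l) s ⟩
      (f i • v j) * W v l s + - wedge (v j) (ι (f i) (W v l)) s
        ≡⟨ cong₂ (λ a b → a * W v l s + - b) (f•v≡0 i≢j) (wedge-zero (v j) (ι-dual l i∉l) s) ⟩
      0# * W v l s + - 0#
        ≡⟨ solve 1 (λ x → con 0ℤ :* x :+ :- con 0ℤ := con 0ℤ) refl _ ⟩
      0#                                                 ∎

    -- Contraction by `f i` sends `v i` to 1 and kills the remaining wedge, because `i` does not
    -- recur in a unique list.
    gram-dual : ∀ {l} → Unique l → ⟪ W f l , W v l ⟫ ≡ 1#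
    gram-dual []                    = ⟪one,one⟫ n
    gram-dual {i ∷ l} (i∉l ∷ uniq) = begin
      ⟪ W f (i ∷ l) , W v (i ∷ l) ⟫           ≡⟨ wedge-adjoint (f i) (W f l) _ ⟩
      ⟪ W f l , ι (f i) (W v (i ∷ l)) ⟫
        ≡⟨ ⟪⟫-congʳ (W f l) (λ s → trans (clifford (f i) (v i) (W v l) s)
        (trans (cong₂ (λ a b → a * W v l s + - b) (f•v≡1 i) (wedge-zero (v i) (ι-dual l i∉l) s))
               (solve 1 (λ x → con 1ℤ :* x :+ :- con 0ℤ := x) refl _))) ⟩
      ⟪ W f l , W v l ⟫                       ≡⟨ gram-dual uniq ⟩
      1#                                      ∎

  Homogeneous : ∀ {n} → ℕ → Λ n → Set
  Homogeneous m x = ∀ s → ∣ s ∣ ≢ m → x s ≡ 0#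

  one-homogeneous : ∀ {n} → Homogeneous {n} 0 one
  one-homogeneous []          0≢0 = ⊥-elim (0≢0 refl)
  one-homogeneous (outside ∷ s) s≢0 = one-homogeneous s s≢0
  one-homogeneous (inside ∷ s)  _   = refl

  wedge-homogeneous : ∀ {n} m (v : Vect n) {x} → Homogeneous m x → Homogeneous (suc m) (wedge v x)
  wedge-homogeneous m v hx []          _ = refl
  wedge-homogeneous m v hx (outside ∷ s) s≢ =
      wedge-homogeneous m (v ∘ suc) (λ t → hx (outside ∷ t)) s s≢
  wedge-homogeneous m v {x} hx (inside ∷ s) s≢ = begin
    v zero * x (outside ∷ s) + - wedge (v ∘ suc) (x ∘ (inside ∷_)) s
      ≡⟨ cong₂ (λ a b → v zero * a + - b) (hx (outside ∷ s) (λ e → s≢ (cong suc e)))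
          (rest m hx s≢) ⟩
    v zero * 0# + - 0#  ≡⟨ solve 1 (λ x → x :* con 0ℤ :+ :- con 0ℤ := con 0ℤ) refl _ ⟩
    0#                  ∎
    where
    -- The part of `x` containing e₀ has tails of degree m - 1; for m = 0 there is no such degree
    -- and that part vanishes altogether.
    rest : ∀ m → Homogeneous m x → suc (∣ s ∣) ≢ suc m → wedge (v ∘ suc) (x ∘ (inside ∷_)) s ≡ 0#
    rest zero    hx _  = wedge-zero (v ∘ suc) (λ t → hx (inside ∷ t) λ ()) s
    rest (suc m) hx s≢ = wedge-homogeneous m (v ∘ suc)
        (λ t t≢m → hx (inside ∷ t) (t≢m ∘ ℕₚ.suc-injective)) s (s≢ ∘ cong suc)

  W-homogeneous : ∀ {n} {I : Set} (v : I → Vect n) l → Homogeneous (length l) (W v l)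
  W-homogeneous v []      = one-homogeneous
  W-homogeneous v (i ∷ l) = wedge-homogeneous (length l) (v i) (W-homogeneous v l)

  -- The top exterior power is spanned by the single basis wedge `⊤`, so one term of the pairing
  -- survives.
  ⟪⟫-top : ∀ {n} (x y : Λ n) → Homogeneous n y → ⟪ x , y ⟫ ≡ x ⊤ * y ⊤
  ⟪⟫-top {zero}  x y hy = refl
  ⟪⟫-top {suc n} x y hy = trans
    (cong₂ _+_ (⟪⟫-zeroʳ _ (λ t → hy (outside ∷ t) (ℕₚ.<⇒≢ (ℕ.s≤s (∣p∣≤n t)))))
               (⟪⟫-top _ _ (λ t t≢n → hy (inside ∷ t) (t≢n ∘ ℕₚ.suc-injective))))
    (+-identityˡ _)

  -- The usual determinant, with `A i` read as row i: the coordinate of the wedge of all rows in the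
  -- one-dimensional top power.
  det : ∀ {n} → Mat n → Carrier
  det {n} A = W A (allFin n) ⊤

  -- The left side is the determinant of A Bᵀ, so this is multiplicativity in disguise.
  gram-det : ∀ {n} (A B : Mat n) → ⟪ W A (allFin n) , W B (allFin n) ⟫ ≡ det A * det B
  gram-det {n} A B = ⟪⟫-top _ _ (subst (λ m → Homogeneous m (W B (allFin n)))
      (length-tabulate (λ i → i)) (W-homogeneous B (allFin n)))

  idM-diag : ∀ {n} (i : Fin n) → idM i i ≡ 1#
  idM-diag zero    = refl
  idM-diag (suc i) = idM-diag i

  idM-off-diag : ∀ {n} {i j : Fin n} → i ≢ j → idM i j ≡ 0#
  idM-off-diag {i = zero}  {zero}  i≢j = ⊥-elim (i≢j refl)
  idM-off-diag {i = zero}  {suc j} i≢j = refl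
  idM-off-diag {i = suc i} {zero}  i≢j = refl
  idM-off-diag {i = suc i} {suc j} i≢j = idM-off-diag (i≢j ∘ cong suc)

  idM-sym : ∀ {n} (i j : Fin n) → idM i j ≡ idM j i
  idM-sym zero    zero    = refl
  idM-sym zero    (suc j) = refl
  idM-sym (suc i) zero    = refl
  idM-sym (suc i) (suc j) = idM-sym i j

  Σ-zero : ∀ n {f : Vect n} → (∀ i → f i ≡ 0#) → Σ n f ≡ 0#
  Σ-zero zero    f≡0 = refl
  Σ-zero (suc n) f≡0 = trans (cong₂ _+_ (f≡0 zero) (Σ-zero n (f≡0 ∘ suc))) (+-identityˡ 0#)

  •-comm : ∀ {n} (f v : Vect n) → f • v ≡ v • f
  •-comm {zero}  f v = refl
  •-comm {suc n} f v = cong₂ _+_ (*-comm _ _) (•-comm (f ∘ suc) (v ∘ suc))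

  idM-• : ∀ {n} (i : Fin n) (v : Vect n) → idM i • v ≡ v i
  idM-• {suc n} zero    v = trans (cong₂ _+_ (*-identityˡ _) (Σ-zero n (λ i → zeroˡ _)))
      (+-identityʳ _)
  idM-• {suc n} (suc i) v = trans (cong₂ _+_ (zeroˡ _) (idM-• i (v ∘ suc))) (+-identityˡ _)

  det-nonzero : ∀ {n} (A B : Mat n) → (∀ i j → A i • B j ≡ idM i j) → det B ≢ 0#
  det-nonzero {n} A B A•B≡I detB≡0 = 0≢1 (begin
    0#                                    ≡⟨ zeroʳ _ ⟨
    det A * 0#                            ≡⟨ cong (det A *_) detB≡0 ⟨
    det A * det B                         ≡⟨ gram-det A B ⟨
    ⟪ W A (allFin n) , W B (allFin n) ⟫   ≡⟨ gram-dual A B (λ i → trans (A•B≡I i i) (idM-diag i))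
                                              (λ i≢j → trans (A•B≡I _ _) (idM-off-diag i≢j))
                                                  (allFin⁺ n) ⟩
    1#                                    ∎)

  -- The pair (I, A) and the pair (B, I) have the same matrix of scalar products, so `gram-cong`
  -- equates their pairings, and the common factor det I is cancelled.
  det-transpose : ∀ {n} (A B : Mat n) → (∀ i j → A i j ≡ B j i) → det A ≡ det B
  det-transpose {n} A B A≡Bᵀ = *-cancelˡ (det-nonzero {n} idM idM
      (λ i j → trans (idM-• i (idM j)) (idM-sym j i)))
    (begin
      det {n} idM * det A                          ≡⟨ gram-det {n} idM A ⟨
      ⟪ W {n} idM (allFin n) , W A (allFin n) ⟫
        ≡⟨ gram-cong idM A B idM (λ j i → trans (idM-• j (A i))
          (trans (A≡Bᵀ i j) (trans (sym (idM-• i (B j))) (•-comm (idM i) (B j))))) (allFin n)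
              (allFin n) ⟩
      ⟪ W B (allFin n) , W {n} idM (allFin n) ⟫    ≡⟨ gram-det {n} B idM ⟩
      det B * det {n} idM                          ≡⟨ *-comm _ _ ⟩
      det {n} idM * det B                          ∎)

-- Degrees and leading parts of functions, by finite differences.

module FiniteDifferences (K : FiniteField) (p-1 : ℕ) (p-prime : Prime (suc p-1))
  (char-p : HasCharacteristic K (suc p-1))
  {G : Set} (_∙_ : G → G → G) where
  private
    p = suc p-1

  open FiniteField K
  open FieldProperties K
  open Frobenius K p-1 p-prime char-p
  open ≡-Reasoning

  Δ : G → (G → Carrier) → (G → Carrier)
  Δ v f x = f (x ∙ v) + - f x

  -- f has degree below m as a function on the group G; in coordinates over 𝔽ₚ this
  -- is the reduced degree, so that x ↦ φ x ^ p has degree 1 for additive φ.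
  DegreeBelow : ℕ → (G → Carrier) → Set
  DegreeBelow zero    f = ∀ x → f x ≡ 0#
  DegreeBelow (suc m) f = ∀ v → DegreeBelow m (Δ v f)

  below-cong : ∀ m {f g} → (∀ x → f x ≡ g x) → DegreeBelow m f → DegreeBelow m g
  below-cong zero    f≡g d x = trans (sym (f≡g x)) (d x)
  below-cong (suc m) f≡g d v = below-cong m (λ x → cong₂ (λ a b → a + - b) (f≡g (x ∙ v)) (f≡g x))
      (d v)

  below-suc : ∀ m {f} → DegreeBelow m f → DegreeBelow (suc m) f
  below-suc zero    d v x = trans (cong₂ (λ a b → a + - b) (d (x ∙ v)) (d x)) (-‿inverseʳ 0#)
  below-suc (suc m) d v   = below-suc m (d v)

  below-zero : ∀ m {f} → (∀ x → f x ≡ 0#) → DegreeBelow m f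
  below-zero zero    f≡0 = f≡0
  below-zero (suc m) f≡0 = below-suc m (below-zero m f≡0)

  below-+ : ∀ m {f g} → DegreeBelow m f → DegreeBelow m g → DegreeBelow m (λ x → f x + g x)
  below-+ zero    df dg x = trans (cong₂ _+_ (df x) (dg x)) (+-identityʳ 0#)
  below-+ (suc m) {f} {g} df dg v = below-cong m
    (λ x → solve 4 (λ a b c d → (a :+ :- b) :+ (c :+ :- d) := (a :+ c) :+ :- (b :+ d)) refl
        (f (x ∙ v)) (f x) (g (x ∙ v)) (g x))
    (below-+ m (df v) (dg v))

  below-neg : ∀ m {f} → DegreeBelow m f → DegreeBelow m (λ x → - f x)
  below-neg zero    df x = trans (cong -_ (df x)) (solve 0 (:- con 0ℤ := con 0ℤ) refl)
  below-neg (suc m) {f} df v = below-cong m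
    (λ x → solve 2 (λ a b → :- (a :+ :- b) := :- a :+ :- (:- b)) refl (f (x ∙ v)) (f x))
        (below-neg m (df v))

  below-Δ : ∀ m {f} v → DegreeBelow m f → DegreeBelow m (Δ v f)
  below-Δ m v d = below-suc m d v

  below-shift : ∀ m {f} v → DegreeBelow m f → DegreeBelow m (λ x → f (x ∙ v))
  below-shift m {f} v d = below-cong m (λ x →
      solve 2 (λ a b → a :+ (b :+ :- a) := b) refl (f x) (f (x ∙ v)))
    (below-+ m d (below-Δ m v d))

  -- Leibniz rule: Δ (f g) is Δ f times the shifted g, plus f times Δ g. Since bounds are strict,
  -- degrees add up under `suc`; the variants `below-*ˡ` and `below-*ʳ` also admit bound 0, which a
  -- difference may reach.
  below-* : ∀ a b {f g} → DegreeBelow (suc a) f → DegreeBelow (suc b) g →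
      DegreeBelow (suc (a ℕ.+ b)) (λ x → f x * g x)
  below-*ˡ : ∀ a b {f g} → DegreeBelow a f → DegreeBelow (suc b) g →
      DegreeBelow (a ℕ.+ b) (λ x → f x * g x)
  below-*ʳ : ∀ a b {f g} → DegreeBelow (suc a) f → DegreeBelow b g →
      DegreeBelow (a ℕ.+ b) (λ x → f x * g x)

  below-* a b {f} {g} df dg v = below-cong (a ℕ.+ b)
    (λ x → solve 4 (λ f′ f g′ g → (f′ :+ :- f) :* g′ :+ f :* (g′ :+ :- g) :=
        f′ :* g′ :+ :- (f :* g)) refl (f (x ∙ v)) (f x) (g (x ∙ v)) (g x))
    (below-+ (a ℕ.+ b) (below-*ˡ a b (df v) (below-shift (suc b) v dg)) (below-*ʳ a b df (dg v)))
  below-*ˡ zero    b df dg = below-zero b (λ x → trans (cong (_* _) (df x)) (zeroˡ _))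
  below-*ˡ (suc a) b df dg = below-* a b df dg
  below-*ʳ a zero    df dg = below-zero (a ℕ.+ 0) (λ x → trans (cong (_ *_) (dg x)) (zeroʳ _))
  below-*ʳ a (suc b) {f} {g} df dg = subst (λ m → DegreeBelow m (λ x → f x * g x))
      (sym (ℕₚ.+-suc a b)) (below-* a b df dg)

  -- The Frobenius map is additive and hence commutes with `Δ v`, so a p-th power costs no degree.
  below-^p : ∀ m {f} → DegreeBelow m f → DegreeBelow m (λ x → f x ^ p)
  below-^p zero    df x = trans (cong (_^ p) (df x)) ^p-0
  below-^p (suc m) {f} df v = below-cong m
    (λ x → trans (^p-homo-+ (f (x ∙ v)) (- f x)) (cong (f (x ∙ v) ^ p +_) (^p-homo-neg (f x))))
        (below-^p m (df v))

  below-const : ∀ c → DegreeBelow 1 (λ _ → c)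
  below-const c v x = -‿inverseʳ c

  -- Without coordinates there are no leading forms to compare, so their equality is expressed by a
  -- drop in the degree of f - g. The bounds on f and g are carried along because f f′ - g g′ = (f -
  -- g) f′ + g (f′ - g′) needs them.
  record SameLeadingPart (a : ℕ) (f g : G → Carrier) : Set where
    constructor leading
    field
      degreeˡ    : DegreeBelow (suc a) f
      degreeʳ    : DegreeBelow (suc a) g
      difference : DegreeBelow a (λ x → f x + - g x)
  open SameLeadingPart public

  leading-const : ∀ c → SameLeadingPart 0 (λ _ → c) (λ _ → c)
  leading-const c = leading (below-const c) (below-const c) (λ _ → -‿inverseʳ c)

  leading-zero : ∀ a → SameLeadingPart a (λ _ → 0#) (λ _ → 0#)
  leading-zero a = leading (below-zero (suc a) (λ _ → refl)) (below-zero (suc a) (λ _ → refl))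
      (below-zero a (λ _ → -‿inverseʳ 0#))

  leading-+ : ∀ {a f g f′ g′} → SameLeadingPart a f g → SameLeadingPart a f′ g′ →
              SameLeadingPart a (λ x → f x + f′ x) (λ x → g x + g′ x)
  leading-+ {a} {f} {g} {f′} {g′} (leading df dg d) (leading df′ dg′ d′) = leading
    (below-+ (suc a) df df′) (below-+ (suc a) dg dg′) (below-cong a
      (λ x → solve 4 (λ f g f′ g′ → (f :+ :- g) :+ (f′ :+ :- g′) := (f :+ f′) :+ :- (g :+ g′)) refl
          (f x) (g x) (f′ x) (g′ x))
      (below-+ a d d′))

  leading-neg : ∀ {a f g} → SameLeadingPart a f g → SameLeadingPart a (λ x → - f x) (λ x → - g x)
  leading-neg {a} {f} {g} (leading df dg d) = leading (below-neg (suc a) df) (below-neg (suc a) dg)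
    (below-cong a (λ x → solve 2 (λ f g → :- (f :+ :- g) := :- f :+ :- (:- g)) refl (f x) (g x))
        (below-neg a d))

  leading-* : ∀ {a b f g f′ g′} → SameLeadingPart a f g → SameLeadingPart b f′ g′ →
              SameLeadingPart (a ℕ.+ b) (λ x → f x * f′ x) (λ x → g x * g′ x)
  leading-* {a} {b} {f} {g} {f′} {g′} (leading df dg d) (leading df′ dg′ d′) = leading
    (below-* a b df df′) (below-* a b dg dg′) (below-cong (a ℕ.+ b)
      (λ x → solve 4 (λ f g f′ g′ → (f :+ :- g) :* f′ :+ g :* (f′ :+ :- g′) :=
          f :* f′ :+ :- (g :* g′)) refl (f x) (g x) (f′ x) (g′ x))
      (below-+ (a ℕ.+ b) (below-*ˡ a b d df′) (below-*ʳ a b dg d′)))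

  leading-^ : ∀ {a f g} n → SameLeadingPart a f g →
      SameLeadingPart (n ℕ.* a) (λ x → f x ^ n) (λ x → g x ^ n)
  leading-^ zero    l = leading-const 1#
  leading-^ (suc n) l = leading-* l (leading-^ n l)

  leading-^p : ∀ {a f g} → SameLeadingPart a f g → SameLeadingPart a (λ x → f x ^ p) (λ x → g x ^ p)
  leading-^p {a} {f} {g} (leading df dg d) = leading (below-^p (suc a) df) (below-^p (suc a) dg)
    (below-cong a (λ x → trans (^p-homo-+ (f x) (- g x)) (cong (f x ^ p +_) (^p-homo-neg (g x))))
        (below-^p a d))

  leading-unitPower : ∀ {a f g} e → SameLeadingPart a f g →
                      SameLeadingPart (e ℕ.* (p-1 ℕ.* a)) (unitPower e ∘ f) (unitPower e ∘ g)
  leading-unitPower zero    l = leading-const 1#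
  leading-unitPower (suc e) l = leading-* (leading-^ p-1 l) (leading-^p (leading-unitPower e l))

  Δ^ : ℕ → G → (G → Carrier) → (G → Carrier)
  Δ^ zero    v f = f
  Δ^ (suc k) v f = Δ^ k v (Δ v f)

  below-Δ^ : ∀ k {m f} v → DegreeBelow (k ℕ.+ m) f → DegreeBelow m (Δ^ k v f)
  below-Δ^ zero    v d = d
  below-Δ^ (suc k) v d = below-Δ^ k v (d v)

-- Leading parts of determinants.

module Determinants (K : FiniteField) (q : ℕ) (p-1 : ℕ) (p-prime : Prime (suc p-1))
  (char-p : HasCharacteristic K (suc p-1))
  {G : Set} (_∙_ : G → G → G) where
  open FiniteField K
  open FieldProperties K
  open Geometry K q using (Vect; Mat)
  open ExteriorAlgebra K q
  open FiniteDifferences K p-1 p-prime char-p _∙_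

  leading-one : ∀ {n} s → SameLeadingPart 0 (λ _ → one {n} s) (λ _ → one {n} s)
  leading-one s = leading-const (one s)

  leading-wedge : ∀ {a n} (v v′ : G → Vect n) (X X′ : G → Λ n) →
                  (∀ i → SameLeadingPart 1 (λ x → v x i) (λ x → v′ x i)) →
                  (∀ s → SameLeadingPart a (λ x → X x s) (λ x → X′ x s)) →
                  ∀ s → SameLeadingPart (suc a) (λ x → wedge (v x) (X x) s)
                      (λ x → wedge (v′ x) (X′ x) s)
  leading-wedge {a} v v′ X X′ lv lX [] = leading-zero (suc a)
  leading-wedge v v′ X X′ lv lX (outside ∷ s) =
    leading-wedge (λ x → v x ∘ suc) (λ x → v′ x ∘ suc) _ _ (lv ∘ suc) (λ t → lX (outside ∷ t)) s
  leading-wedge v v′ X X′ lv lX (inside ∷ s) = leading-+ (leading-* (lv zero) (lX (outside ∷ s)))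
    (leading-neg (leading-wedge (λ x → v x ∘ suc) (λ x → v′ x ∘ suc) _ _ (lv ∘ suc)
        (λ t → lX (inside ∷ t)) s))

  -- Proved for all coordinates `s`, although the determinant is only the one at `⊤`, because each
  -- wedge combines several coordinates of the previous one.
  leading-W : ∀ {n} {I : Set} (v v′ : G → I → Vect n) →
              (∀ i j → SameLeadingPart 1 (λ x → v x i j) (λ x → v′ x i j)) →
              ∀ l s → SameLeadingPart (length l) (λ x → W (v x) l s) (λ x → W (v′ x) l s)
  leading-W v v′ lv []      s = leading-one s
  leading-W v v′ lv (i ∷ l) s = leading-wedge (λ x → v x i) (λ x → v′ x i) _ _ (lv i)
      (leading-W v v′ lv l) s

  leading-det : ∀ {n} (A A′ : G → Mat n) →
      (∀ i j → SameLeadingPart 1 (λ x → A x i j) (λ x → A′ x i j)) →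
                SameLeadingPart n (λ x → det (A x)) (λ x → det (A′ x))
  leading-det {n} A A′ lA = subst (λ m → SameLeadingPart m (λ x → det (A x)) (λ x → det (A′ x)))
    (length-tabulate (λ i → i)) (leading-W A A′ lA (allFin n) ⊤)

-- The degree of an indicator function on an elementary abelian group.

-- Otherwise the position in `L` would inject `Fin N` into `Fin (length L)`.
∃∉ : ∀ {N} (L : List (Fin N)) → length L ℕ.< N → ∃ λ v → v ∉ L
∃∉ {N} L L<N with Finₚ.any? (λ v → ¬? (v ∈? L))
  where open DecMembership (Finₚ._≟_ {N}) using (_∈?_)
... | yes found = found
... | no  none  = ⊥-elim (ℕₚ.<⇒≱ L<N (Finₚ.injective⇒≤ {f = λ v → index (all∈ v)}
                    (Membership.index-injective (≡-setoid _) (all∈ _) (all∈ _))))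
  where
  open DecMembership (Finₚ._≟_ {N}) using (_∈?_)
  all∈ : ∀ v → v ∈ L
  all∈ v = decidable-stable (v ∈? L) (λ v∉L → none (v , v∉L))

length-cartesianProductWith : ∀ {A B C : Set} (f : A → B → C) xs ys →
                              length (cartesianProductWith f xs ys) ≡ length xs ℕ.* length ys
length-cartesianProductWith f []       ys = refl
length-cartesianProductWith f (x ∷ xs) ys = trans (length-++ (map (f x) ys))
  (cong₂ ℕ._+_ (length-map (f x) ys) (length-cartesianProductWith f xs ys))

module ElementaryAbelian (K : FiniteField) (p-1 : ℕ) (p-prime : Prime (suc p-1))
  (char-p : HasCharacteristic K (suc p-1))
  {N : ℕ} {_∙_ : Fin N → Fin N → Fin N} {ε : Fin N}
      (isCommutativeMonoid : IsCommutativeMonoid _≡_ _∙_ ε) where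
  private
    p = suc p-1

  open FiniteField K
  open FieldProperties K using (solve; _:=_; _:+_; :-_; con)
  open FiniteDifferences K p-1 p-prime char-p _∙_
  monoid : Monoid 0ℓ 0ℓ
  monoid = record { isMonoid = IsCommutativeMonoid.isMonoid isCommutativeMonoid }

  open import Algebra.Properties.Monoid.Mult monoid
    using (×-homo-+; ×-assocˡ; ×-homo-1) renaming (_×_ to _·_)
  open IsCommutativeMonoid isCommutativeMonoid using (assoc; comm; identityˡ; identityʳ)
  open ≡-Reasoning

  private
    G = Fin N

  -- An iterated difference at x is a combination of the values at x + j v with 0 ≤ j ≤ k.
  Δ^-vanishes : ∀ k v f x → (∀ j → j ℕ.≤ k → f (x ∙ (j · v)) ≡ 0#) → Δ^ k v f x ≡ 0#
  Δ^-vanishes zero    v f x f≡0 = trans (cong f (sym (identityʳ x))) (f≡0 0 ℕ.z≤n)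
  Δ^-vanishes (suc k) v f x f≡0 = Δ^-vanishes k v (Δ v f) x λ j j≤k → begin
    f ((x ∙ (j · v)) ∙ v) + - f (x ∙ (j · v))
      ≡⟨ cong₂ (λ a b → f a + - b) (trans (assoc x (j · v) v) (cong (x ∙_) (comm (j · v) v)))
          (f≡0 j (ℕₚ.m≤n⇒m≤1+n j≤k)) ⟩
    f (x ∙ (suc j · v)) + - 0#    ≡⟨ cong (_+ - 0#) (f≡0 (suc j) (ℕ.s≤s j≤k)) ⟩
    0# + - 0#                     ≡⟨ solve 0 (con 0ℤ :+ :- con 0ℤ := con 0ℤ) refl ⟩
    0#                            ∎

  -- In that combination the value at x itself has coefficient 1 or -1, and it is the only value
  -- left.
  Δ^-nonzero : ∀ k v f x → (∀ j → 1 ℕ.≤ j → j ℕ.≤ k → f (x ∙ (j · v)) ≡ 0#) → f x ≢ 0# →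
      Δ^ k v f x ≢ 0#
  Δ^-nonzero zero    v f x f≡0 fx≢0 = fx≢0
  Δ^-nonzero (suc k) v f x f≡0 fx≢0 = Δ^-nonzero k v (Δ v f) x
    (λ j 1≤j j≤k → begin
      f ((x ∙ (j · v)) ∙ v) + - f (x ∙ (j · v))
        ≡⟨ cong₂ (λ a b → f a + - b) (trans (assoc x (j · v) v) (cong (x ∙_) (comm (j · v) v)))
            (f≡0 j 1≤j (ℕₚ.m≤n⇒m≤1+n j≤k)) ⟩
      f (x ∙ (suc j · v)) + - 0#    ≡⟨ cong (_+ - 0#) (f≡0 (suc j) (ℕ.s≤s ℕ.z≤n) (ℕ.s≤s j≤k)) ⟩
      0# + - 0#                     ≡⟨ solve 0 (con 0ℤ :+ :- con 0ℤ := con 0ℤ) refl ⟩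
      0#                            ∎)
    (λ Δfx≡0 → fx≢0 (begin
      f x
        ≡⟨ solve 2 (λ a b → a := b :+ :- (b :+ :- a)) refl (f x) (f (x ∙ v)) ⟩
      f (x ∙ v) + - Δ v f x         ≡⟨ cong₂ (λ a b → a + - b)
                                         (trans (cong (λ w → f (x ∙ w)) (sym (×-homo-1 v)))
                                             (f≡0 1 ℕₚ.≤-refl (ℕ.s≤s ℕ.z≤n))) Δfx≡0 ⟩
      0# + - 0#                     ≡⟨ solve 0 (con 0ℤ :+ :- con 0ℤ := con 0ℤ) refl ⟩
      0#                            ∎))

  module _ (p·x≡ε : ∀ x → p · x ≡ ε) where

    n·ε≡ε : ∀ n → n · ε ≡ ε
    n·ε≡ε zero    = refl
    n·ε≡ε (suc n) = trans (identityˡ _) (n·ε≡ε n)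

    n·p·x≡ε : ∀ n x → (n ℕ.* p) · x ≡ ε
    n·p·x≡ε n x = trans (sym (×-assocˡ x n p)) (trans (cong (n ·_) (p·x≡ε x)) (n·ε≡ε n))

    %p· : ∀ n x → n · x ≡ (n ℕ.% p) · x
    %p· n x = begin
      n · x                                          ≡⟨ cong (_· x) (ℕ.m≡m%n+[m/n]*n n p) ⟩
      (n ℕ.% p ℕ.+ (n ℕ./ p) ℕ.* p) · x              ≡⟨ ×-homo-+ x (n ℕ.% p) _ ⟩
      ((n ℕ.% p) · x) ∙ (((n ℕ./ p) ℕ.* p) · x)
        ≡⟨ cong (((n ℕ.% p) · x) ∙_) (n·p·x≡ε (n ℕ./ p) x) ⟩
      ((n ℕ.% p) · x) ∙ ε                            ≡⟨ identityʳ _ ⟩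
      (n ℕ.% p) · x                                  ∎

    record IsSubmonoid (L : List G) : Set where
      field
        ε∈       : ε ∈ L
        ∙-closed : ∀ {x y} → x ∈ L → y ∈ L → (x ∙ y) ∈ L

      ·-closed : ∀ n {x} → x ∈ L → (n · x) ∈ L
      ·-closed zero    x∈ = ε∈
      ·-closed (suc n) x∈ = ∙-closed x∈ (·-closed n x∈)

      -- As j is invertible modulo p, v is a multiple of j v.
      root-closed : ∀ {j v} → 1 ℕ.≤ j → j ℕ.< p → (j · v) ∈ L → v ∈ L
      root-closed {j} {v} 1≤j j<p jv∈ with coprime-Bézout
          (prime⇒coprime p-prime {{ℕ.>-nonZero 1≤j}} j<p)
      ... | Bézout.-+ x y 1+xp≡yj = subst (_∈ L) (begin
        y · (j · v)           ≡⟨ ×-assocˡ v y j ⟩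
        (y ℕ.* j) · v         ≡⟨ cong (_· v) 1+xp≡yj ⟨
        v ∙ ((x ℕ.* p) · v)   ≡⟨ cong (v ∙_) (n·p·x≡ε x v) ⟩
        v ∙ ε                 ≡⟨ identityʳ v ⟩
        v                     ∎) (·-closed y jv∈)
      -- Here y j is -1 modulo p, so w = y j v is the inverse of v, and p - 1 copies of w invert it
      -- back.
      ... | Bézout.+- x y 1+yj≡xp = subst (_∈ L) (begin
        p-1 · w                    ≡⟨ identityˡ _ ⟨
        ε ∙ (p-1 · w)              ≡⟨ cong (_∙ (p-1 · w)) v∙w≡ε ⟨
        (v ∙ w) ∙ (p-1 · w)        ≡⟨ assoc v w (p-1 · w) ⟩
        v ∙ (p · w)                ≡⟨ cong (v ∙_) (p·x≡ε w) ⟩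
        v ∙ ε                      ≡⟨ identityʳ v ⟩
        v                          ∎) (·-closed p-1 (·-closed y jv∈))
        where
        w = y · (j · v)
        v∙w≡ε : v ∙ w ≡ ε
        v∙w≡ε = trans (cong (v ∙_) (×-assocˡ v y j)) (trans (cong (_· v) 1+yj≡xp) (n·p·x≡ε x v))

    -- The span of `L` and `v`, listed translate by translate. Only its length is tracked, since a
    -- list shorter than N must miss some element.
    adjoin : List G → G → List G
    adjoin L v = cartesianProductWith (λ x j → x ∙ (j · v)) L (upTo p)

    ∈-adjoin : ∀ {L x} v n → x ∈ L → (x ∙ (n · v)) ∈ adjoin L v
    ∈-adjoin v n x∈ = subst (λ w → (_ ∙ w) ∈ _) (sym (%p· n v))
      (∈-cartesianProductWith⁺ (λ x j → x ∙ (j · v)) x∈ (∈-upTo⁺ (ℕ.m%n<n n p)))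

    adjoin-isSubmonoid : ∀ {L} v → IsSubmonoid L → IsSubmonoid (adjoin L v)
    adjoin-isSubmonoid {L} v isSub = record
      { ε∈ = subst (_∈ adjoin L v) (identityʳ ε) (∈-adjoin v 0 ε∈)
      ; ∙-closed = closed
      }
      where
      open IsSubmonoid isSub
      closed : ∀ {a b} → a ∈ adjoin L v → b ∈ adjoin L v → (a ∙ b) ∈ adjoin L v
      closed a∈ b∈ with ∈-cartesianProductWith⁻ _ L (upTo p) a∈ | ∈-cartesianProductWith⁻ _ L
          (upTo p) b∈
      ... | x , j , x∈ , _ , refl | y , k , y∈ , _ , refl = subst (_∈ adjoin L v) (begin
        (x ∙ y) ∙ ((j ℕ.+ k) · v)         ≡⟨ cong ((x ∙ y) ∙_) (×-homo-+ v j k) ⟩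
        (x ∙ y) ∙ ((j · v) ∙ (k · v))     ≡⟨ assoc x y _ ⟩
        x ∙ (y ∙ ((j · v) ∙ (k · v)))     ≡⟨ cong (x ∙_) (assoc y _ _) ⟨
        x ∙ ((y ∙ (j · v)) ∙ (k · v))     ≡⟨ cong (λ w → x ∙ (w ∙ (k · v))) (comm y (j · v)) ⟩
        x ∙ (((j · v) ∙ y) ∙ (k · v))     ≡⟨ cong (x ∙_) (assoc _ y _) ⟩
        x ∙ ((j · v) ∙ (y ∙ (k · v)))     ≡⟨ assoc x _ _ ⟨
        (x ∙ (j · v)) ∙ (y ∙ (k · v))     ∎) (∈-adjoin v (j ℕ.+ k) (∙-closed x∈ y∈))

    -- Passing from (L, e) to (adjoin L v, Δ^ (p-1) v e) lowers the degree by p - 1 and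
    -- multiplies the length by p; after s steps e vanishes identically.
    supported⇒large-degree : ∀ s L → length L ℕ.* p ℕ.^ s ≡ N → IsSubmonoid L →
      ∀ e → (∀ x → x ∉ L → e x ≡ 0#) → e ε ≢ 0# → ¬ DegreeBelow (s ℕ.* p-1) e
    supported⇒large-degree zero    L _     _     e _    eε≢0 d = eε≢0 (d ε)
    supported⇒large-degree (suc s) L L*p^s≡N isSub e supp eε≢0 d =
      supported⇒large-degree s (adjoin L v) length≡ (adjoin-isSubmonoid v isSub) (Δ^ p-1 v e) supp′
        -- The values of e at j v with 0 < j < p are zero: if j v were in L, then so would be v.
        (Δ^-nonzero p-1 v e ε (λ j 1≤j j≤p-1 →
            supp _ (λ jv∈ → v∉L (root-closed 1≤j (ℕ.s≤s j≤p-1) (subst (_∈ L) (identityˡ _) jv∈))))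
            eε≢0)
        (below-Δ^ p-1 v d)
      where
      open IsSubmonoid isSub
      L<N : length L ℕ.< N
      L<N = subst (length L ℕ.<_) L*p^s≡N (ℕₚ.m<m*n (length L) (p ℕ.^ suc s)
        {{ℕ.>-nonZero (nonempty ε∈)}} (ℕₚ.<-≤-trans
            (ℕ.nonTrivial⇒n>1 p {{prime⇒nonTrivial p-prime}})
          (ℕₚ.m≤m*n p (p ℕ.^ s) {{ℕₚ.m^n≢0 p s}})))
        where
        nonempty : ∀ {x : G} {L} → x ∈ L → 0 ℕ.< length L
        nonempty {L = _ ∷ _} _ = ℕ.s≤s ℕ.z≤n
      v = proj₁ (∃∉ L L<N)
      v∉L = proj₂ (∃∉ L L<N)
      length≡ : length (adjoin L v) ℕ.* p ℕ.^ s ≡ N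
      length≡ = begin
        length (adjoin L v) ℕ.* p ℕ.^ s
          ≡⟨ cong (ℕ._* p ℕ.^ s) (length-cartesianProductWith (λ x j → x ∙ (j · v)) L (upTo p)) ⟩
        length L ℕ.* length (upTo p) ℕ.* p ℕ.^ s
          ≡⟨ cong (λ k → length L ℕ.* k ℕ.* p ℕ.^ s) (length-upTo p) ⟩
        length L ℕ.* p ℕ.* p ℕ.^ s                ≡⟨ ℕₚ.*-assoc (length L) p (p ℕ.^ s) ⟩
        length L ℕ.* (p ℕ.* p ℕ.^ s)              ≡⟨ L*p^s≡N ⟩
        N                                         ∎
      -- If x + j v were in L, adding (p - j) v would bring it back to x and put x into the span.
      supp′ : ∀ x → x ∉ adjoin L v → Δ^ p-1 v e x ≡ 0#
      supp′ x x∉ = Δ^-vanishes p-1 v e x λ j j≤p-1 → supp _ λ xjv∈ →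
          x∉ (subst (_∈ adjoin L v) (begin
        (x ∙ (j · v)) ∙ ((p ℕ.∸ j) · v)    ≡⟨ assoc x _ _ ⟩
        x ∙ ((j · v) ∙ ((p ℕ.∸ j) · v))    ≡⟨ cong (x ∙_) (×-homo-+ v j (p ℕ.∸ j)) ⟨
        x ∙ ((j ℕ.+ (p ℕ.∸ j)) · v)
          ≡⟨ cong (λ k → x ∙ (k · v)) (ℕₚ.m+[n∸m]≡n (ℕₚ.m≤n⇒m≤1+n j≤p-1)) ⟩
        x ∙ (p · v)                        ≡⟨ cong (x ∙_) (p·x≡ε v) ⟩
        x ∙ ε                              ≡⟨ identityʳ x ⟩
        x                                  ∎) (∈-adjoin v (p ℕ.∸ j) xjv∈))

    delta-degree : ∀ d → p ℕ.^ d ≡ N → ∀ e → (∀ x → x ≢ ε → e x ≡ 0#) → e ε ≢ 0# →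
        ¬ DegreeBelow (d ℕ.* p-1) e
    delta-degree d p^d≡N e e≡0 = supported⇒large-degree d (ε ∷ []) (trans (ℕₚ.+-identityʳ _) p^d≡N)
      (record { ε∈ = here refl ; ∙-closed = λ { (here refl) (here refl) → here (identityˡ ε) } })
      e (λ x x∉ → e≡0 x (λ x≡ε → x∉ (here x≡ε)))

-- Pigeonhole principle and finite codes.

-- If `y` were missed, punching it out of the codomain would leave an injection into a smaller set.
Fin-injective⇒surjective : ∀ {n} {f : Fin n → Fin n} → Injective _≡_ _≡_ f → ∀ y → ∃ λ x → f x ≡ y
Fin-injective⇒surjective {suc n} {f} f-inj y with Finₚ.any? (λ x → f x Finₚ.≟ y)
... | yes hit  = hit
... | no  miss = ⊥-elim (ℕₚ.1+n≰n (Finₚ.injective⇒≤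
    {f = λ x → punchOut (λ y≡fx → miss (x , sym y≡fx))}
                   (λ e → f-inj (Finₚ.punchOut-injective (λ y≡fx → miss (_ , sym y≡fx))
                       (λ y≡fx → miss (_ , sym y≡fx)) e))))

-- Vectors are functions, which need not be equal when they agree pointwise; so Fin N codes
-- them only up to _≐_.
record Coding {A : Set} {_≈_ : A → A → Set} (isEquivalence : IsEquivalence _≈_) (N : ℕ) : Set where
  open IsEquivalence isEquivalence using () renaming (sym to ≈-sym; trans to ≈-trans)
  field
    encode        : A → Fin N
    decode        : Fin N → A
    encode-cong   : ∀ {x y} → x ≈ y → encode x ≡ encode y
    encode-decode : ∀ k → encode (decode k) ≡ k
    decode-encode : ∀ x → decode (encode x) ≈ x

  encode-injective : ∀ {x y} → encode x ≡ encode y → x ≈ y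
  encode-injective {x} {y} e =
    ≈-trans (≈-sym (decode-encode x)) (subst (λ k → decode k ≈ y) (sym e) (decode-encode y))

  any? : ∀ {P : A → Set} → (∀ {x y} → x ≈ y → P x → P y) → (∀ x → Dec (P x)) → Dec (∃ P)
  any? P-resp P? = map′ (λ (k , Pk) → decode k , Pk)
    (λ (x , Px) → encode x , P-resp (≈-sym (decode-encode x)) Px) (Finₚ.any? (P? ∘ decode))

  injective⇒surjective : (f : A → A) → (∀ {x y} → f x ≈ f y → x ≈ y) → ∀ y → ∃ λ x → f x ≈ y
  injective⇒surjective f f-inj y = decode k , encode-injective code≡
    where
    code-injective : Injective _≡_ _≡_ (encode ∘ f ∘ decode)
    code-injective {j} {k} e = trans (sym (encode-decode j))
      (trans (encode-cong (f-inj (encode-injective e))) (encode-decode k))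
    preimage = Fin-injective⇒surjective code-injective (encode y)
    k = proj₁ preimage
    code≡ = proj₂ preimage

-- Linear algebra over K and linear functionals on pairs of vectors.

module LinearAlgebra (K : FiniteField) (q : ℕ) where
  open FiniteField K
  open FieldProperties K
  open Geometry K q
  open ExteriorAlgebra K q using (_•_; idM-•; •-comm; Σ-zero; idM-sym; det; det-nonzero)
  open import Algebra.Properties.Semiring.Sum semiring using
      (sum; *-distribˡ-sum; sum-cong-≗; ∑-distrib-+; ∑-comm)
  open Inverse enum using (to; from; strictlyInverseˡ; strictlyInverseʳ)
  open ≡-Reasoning

  ≐-isEquivalence : ∀ {n} → IsEquivalence (_≐_ {n})
  ≐-isEquivalence = record
    { refl  = λ _ → refl
    ; sym   = λ e i → sym (e i)
    ; trans = λ e f i → trans (e i) (f i)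
    }

  ≐₂-isEquivalence : ∀ {n} → IsEquivalence (_≐₂_ {n})
  ≐₂-isEquivalence = record
    { refl  = (λ _ → refl) , (λ _ → refl)
    ; sym   = λ (e , e′) → (λ i → sym (e i)) , (λ i → sym (e′ i))
    ; trans = λ (e , e′) (f , f′) → (λ i → trans (e i) (f i)) , (λ i → trans (e′ i) (f′ i))
    }

  module _ {n : ℕ} where
    open IsEquivalence (≐₂-isEquivalence {n}) public
      using () renaming (refl to ≐₂-refl; sym to ≐₂-sym; trans to ≐₂-trans)

  Vect-coding : ∀ n → Coding (≐-isEquivalence {n}) (size ℕ.^ n)
  Vect-coding n = record
    { encode        = λ u → funToFin (to ∘ u)
    ; decode        = λ k → from ∘ finToFun {size} {n} k
    ; encode-cong   = λ u≐v → funToFin-cong (λ i → cong to (u≐v i))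
    ; encode-decode = λ k → trans (funToFin-cong (λ i → strictlyInverseˡ (finToFun {size} {n} k i)))
        (Finₚ.funToFin-finToFin {n} k)
    ; decode-encode = λ u i → trans (cong from (Finₚ.finToFun-funToFin (to ∘ u) i))
        (strictlyInverseʳ (u i))
    }
    where
    funToFin-cong : ∀ {m n} {f g : Fin m → Fin n} → (∀ i → f i ≡ g i) → funToFin f ≡ funToFin g
    funToFin-cong {zero}  f≡g = refl
    funToFin-cong {suc m} f≡g = cong₂ combine (f≡g zero) (funToFin-cong (f≡g ∘ suc))

  Vect2-coding : ∀ n → Coding (≐₂-isEquivalence {n}) ((size ℕ.^ n) ℕ.* (size ℕ.^ n))
  Vect2-coding n = record
    { encode        = λ (x , y) → combine (encode x) (encode y)
    ; decode        = λ k → decode (proj₁ (remQuot {N} N k)) , decode (proj₂ (remQuot {N} N k))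
    ; encode-cong   = λ (e₁ , e₂) → cong₂ combine (encode-cong e₁) (encode-cong e₂)
    ; encode-decode = λ k → trans (cong₂ combine (encode-decode _) (encode-decode _))
        (Finₚ.combine-remQuot {N} N k)
    ; decode-encode = λ (x , y) →
        subst (λ k → decode k ≐ x) (sym (cong proj₁
            (Finₚ.remQuot-combine {N} (encode x) (encode y)))) (decode-encode x) ,
        subst (λ k → decode k ≐ y) (sym (cong proj₂
            (Finₚ.remQuot-combine {N} (encode x) (encode y)))) (decode-encode y)
    }
    where
    N = size ℕ.^ n
    open Coding (Vect-coding n)

  Σ≡sum : ∀ n (f : Vect n) → Σ n f ≡ sum f
  Σ≡sum zero    f = refl
  Σ≡sum (suc n) f = cong (f zero +_) (Σ≡sum n (f ∘ suc))

  Σ-cong : ∀ n {f g : Vect n} → f ≐ g → Σ n f ≡ Σ n g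
  Σ-cong zero    e = refl
  Σ-cong (suc n) e = cong₂ _+_ (e zero) (Σ-cong n (e ∘ suc))

  Σ-+ : ∀ n (f g : Vect n) → Σ n (λ i → f i + g i) ≡ Σ n f + Σ n g
  Σ-+ n f g = trans (Σ≡sum n _) (trans (∑-distrib-+ f g) (sym (cong₂ _+_ (Σ≡sum n f) (Σ≡sum n g))))

  Σ-* : ∀ n c (f : Vect n) → Σ n (λ i → c * f i) ≡ c * Σ n f
  Σ-* n c f = trans (Σ≡sum n _) (trans (sym (*-distribˡ-sum c f)) (cong (c *_) (sym (Σ≡sum n f))))

  Σ-neg : ∀ n (f : Vect n) → Σ n (λ i → - f i) ≡ - Σ n f
  Σ-neg n f = trans (Σ-cong n (λ i → -x≡-1*x (f i)))
      (trans (Σ-* n (- 1#) f) (sym (-x≡-1*x (Σ n f))))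
    where
    -x≡-1*x : ∀ x → - x ≡ - 1# * x
    -x≡-1*x = solve 1 (λ x → :- x := :- con 1ℤ :* x) refl

  Σ-swap : ∀ m n (f : Fin m → Fin n → Carrier) →
      Σ m (λ i → Σ n (f i)) ≡ Σ n (λ j → Σ m (λ i → f i j))
  Σ-swap m n f = begin
    Σ m (λ i → Σ n (f i))              ≡⟨ Σ-cong m (λ i → Σ≡sum n (f i)) ⟩
    Σ m (λ i → sum (f i))              ≡⟨ Σ≡sum m _ ⟩
    sum (λ i → sum (f i))              ≡⟨ ∑-comm f ⟩
    sum (λ j → sum (λ i → f i j))      ≡⟨ Σ≡sum n _ ⟨
    Σ n (λ j → sum (λ i → f i j))      ≡⟨ Σ-cong n (λ j → sym (Σ≡sum m (λ i → f i j))) ⟩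
    Σ n (λ j → Σ m (λ i → f i j))      ∎

  ·-cong : ∀ {n} (A : Mat n) {u v} → u ≐ v → (A · u) ≐ (A · v)
  ·-cong A e i = Σ-cong _ (λ j → cong (A i j *_) (e j))

  ·-⊕ : ∀ {n} (A : Mat n) u v → (A · (u ⊕ v)) ≐ ((A · u) ⊕ (A · v))
  ·-⊕ A u v i = trans (Σ-cong _ (λ j → distribˡ (A i j) (u j) (v j)))
      (Σ-+ _ (λ j → A i j * u j) (λ j → A i j * v j))

  ·-* : ∀ {n} (A : Mat n) c u → (A · (λ i → c * u i)) ≐ (λ i → c * (A · u) i)
  ·-* A c u i = trans (Σ-cong _ (λ j → solve 3 (λ a c u → a :* (c :* u) := c :* (a :* u)) refl
      (A i j) c (u j)))
                      (Σ-* _ c (λ j → A i j * u j))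

  ·-zero : ∀ {n} (A : Mat n) {u} → IsZero u → IsZero (A · u)
  ·-zero {n} A u≡0 i = Σ-zero n (λ j → trans (cong (A i j *_) (u≡0 j)) (zeroʳ _))

  ⊞-· : ∀ {n} (A B : Mat n) u → ((A ⊞ B) · u) ≐ ((A · u) ⊕ (B · u))
  ⊞-· A B u i = trans (Σ-cong _ (λ j → distribʳ (u j) (A i j) (B i j)))
      (Σ-+ _ (λ j → A i j * u j) (λ j → B i j * u j))

  ⊠-· : ∀ {n} (A B : Mat n) u → ((A ⊠ B) · u) ≐ (A · (B · u))
  ⊠-· {n} A B u i = begin
    Σ n (λ j → Σ n (λ k → A i k * B k j) * u j)
      ≡⟨ Σ-cong n (λ j → trans (*-comm _ (u j)) (sym (Σ-* n (u j) _))) ⟩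
    Σ n (λ j → Σ n (λ k → u j * (A i k * B k j)))   ≡⟨ Σ-swap n n _ ⟩
    Σ n (λ k → Σ n (λ j → u j * (A i k * B k j)))   ≡⟨ Σ-cong n (λ k → trans
        (Σ-cong n (λ j → solve 3 (λ u a b → u :* (a :* b) := a :* (b :* u)) refl (u j) (A i k)
            (B k j)))
        (Σ-* n (A i k) _)) ⟩
    Σ n (λ k → A i k * Σ n (λ j → B k j * u j))     ∎

  isZero? : ∀ {n} (u : Vect n) → Dec (IsZero u)
  isZero? u = Finₚ.all? (λ i → u i ≟ 0#)

  _≐?_ : ∀ {n} (u v : Vect n) → Dec (u ≐ v)
  u ≐? v = Finₚ.all? (λ i → u i ≟ v i)

  _⊖_ : ∀ {n} → Mat n → Mat n → Mat n
  (A ⊖ B) i j = A i j + - B i j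

  ⊖-· : ∀ {n} (A B : Mat n) u i → ((A ⊖ B) · u) i ≡ (A · u) i + - (B · u) i
  ⊖-· {n} A B u i = begin
    Σ n (λ j → (A i j + - B i j) * u j)
      ≡⟨ Σ-cong n (λ j → solve 3 (λ a b u → (a :+ :- b) :* u := a :* u :+ :- (b :* u)) refl (A i j)
      (B i j) (u j)) ⟩
    Σ n (λ j → A i j * u j + - (B i j * u j))             ≡⟨ Σ-+ n _ _ ⟩
    (A · u) i + Σ n (λ j → - (B i j * u j))               ≡⟨ cong ((A · u) i +_) (Σ-neg n _) ⟩
    (A · u) i + - (B · u) i                               ∎

  x-y≡0⇒x≡y : ∀ {x y} → x + - y ≡ 0# → x ≡ y
  x-y≡0⇒x≡y {x} {y} e = trans (solve 2 (λ x y → x := (x :+ :- y) :+ y) refl x y)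
      (trans (cong (_+ y) e) (+-identityˡ y))

  Injective-· : ∀ {n} → Mat n → Set
  Injective-· A = ∀ u → IsZero (A · u) → IsZero u

  -- An injective map of the finite set Kⁿ into itself is onto; counting takes the place of Gaussian
  -- elimination.
  injective⇒solvable : ∀ {n} (A : Mat n) → Injective-· A → ∀ y → ∃ λ x → (A · x) ≐ y
  injective⇒solvable {n} A A-inj = Coding.injective⇒surjective (Vect-coding n) (A ·_) inj
    where
    inj : ∀ {x y} → (A · x) ≐ (A · y) → x ≐ y
    inj {x} {y} e i = x-y≡0⇒x≡y (A-inj (λ i → x i + - y i) (λ j → begin
      (A · (λ i → x i + - y i)) j                 ≡⟨ ·-⊕ A x (λ i → - y i) j ⟩
      (A · x) j + (A · (λ i → - y i)) j
        ≡⟨ cong (λ t → (A · x) j + t) (trans (·-cong A (λ i → -1* (y i)) j) (·-* A (- 1#) y j)) ⟩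
      (A · x) j + - 1# * (A · y) j                ≡⟨ cong (λ t → t + - 1# * (A · y) j) (e j) ⟩
      (A · y) j + - 1# * (A · y) j
        ≡⟨ solve 1 (λ t → t :+ :- con 1ℤ :* t := con 0ℤ) refl _ ⟩
      0#                                          ∎) i)
      where
      -1* : ∀ x → - x ≡ - 1# * x
      -1* = solve 1 (λ x → :- x := :- con 1ℤ :* x) refl

  -- The solutions of A x = e_i form a family dual to the rows of A.
  injective⇒det-nonzero : ∀ {n} (A : Mat n) → Injective-· A → det A ≢ 0#
  injective⇒det-nonzero A A-inj = det-nonzero (λ i → proj₁ (solution i)) A
    (λ i j → trans (•-comm (proj₁ (solution i)) (A j)) (proj₂ (solution i) j))
    where solution = λ i → injective⇒solvable A A-inj (idM i)

  invertible⇒det-nonzero : ∀ {n} (A : Mat n) → Invertible A → det A ≢ 0#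
  invertible⇒det-nonzero A (B , A⊠B≐I) = det-nonzero (λ i k → B k i) A
    (λ i j → trans (•-comm (λ k → B k i) (A j)) (trans (A⊠B≐I j i) (idM-sym j i)))

  act-cong : ∀ {n} (g : Block n) {w w′} → w ≐₂ w′ → act g w ≐₂ act g w′
  act-cong (block a b c d) (e , e′) =
    (λ i → cong₂ _+_ (·-cong a e i) (·-cong b e′ i)) ,
        (λ i → cong₂ _+_ (·-cong c e i) (·-cong d e′ i))

  -- `BlockInvertible` provides a left inverse, whereas a generator is pulled back along `h` and
  -- must return under `g`. As `act g` is injective on a finite set it is onto, which makes the
  -- inverse two-sided.
  rightInverse : ∀ {n} (g h : Block n) → (∀ w → act h (act g w) ≐₂ w) → ∀ w → act g (act h w) ≐₂ w
  rightInverse {n} g h hg≐id w = ≐₂-trans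
      (act-cong g (≐₂-trans (act-cong h (≐₂-sym gw′≐w)) (hg≐id w′))) gw′≐w
    where
    preimage = Coding.injective⇒surjective (Vect2-coding n) (act g)
      (λ {x} {y} e → ≐₂-trans (≐₂-sym (hg≐id x)) (≐₂-trans (act-cong h e) (hg≐id y))) w
    w′ = proj₁ preimage
    gw′≐w = proj₂ preimage

  _⊕₂_ : ∀ {n} → Vect2 n → Vect2 n → Vect2 n
  (x , y) ⊕₂ (x′ , y′) = x ⊕ x′ , y ⊕ y′

  _*₂_ : ∀ {n} → Carrier → Vect2 n → Vect2 n
  c *₂ (x , y) = (λ i → c * x i) , (λ i → c * y i)

  act-⊕ : ∀ {n} (g : Block n) w w′ → act g (w ⊕₂ w′) ≐₂ (act g w ⊕₂ act g w′)
  act-⊕ (block a b c d) (x , y) (x′ , y′) = additive a b , additive c d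
    where
    additive : ∀ a b i → ((a · (x ⊕ x′)) ⊕ (b · (y ⊕ y′))) i ≡
        (((a · x) ⊕ (b · y)) ⊕ ((a · x′) ⊕ (b · y′))) i
    additive a b i = trans (cong₂ _+_ (·-⊕ a x x′ i) (·-⊕ b y y′ i))
      (solve 4 (λ p q r s → (p :+ q) :+ (r :+ s) := (p :+ r) :+ (q :+ s)) refl ((a · x) i)
          ((a · x′) i) ((b · y) i) ((b · y′) i))

  act-* : ∀ {n} (g : Block n) k w → act g (k *₂ w) ≐₂ (k *₂ act g w)
  act-* (block a b c d) k (x , y) = homogeneous a b , homogeneous c d
    where
    homogeneous : ∀ a b i → ((a · (λ i → k * x i)) ⊕ (b · (λ i → k * y i))) i ≡ k *
        ((a · x) ⊕ (b · y)) i
    homogeneous a b i = trans (cong₂ _+_ (·-* a k x i) (·-* b k y i)) (sym (distribˡ k _ _))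

  record IsLinear {n} (F : Vect2 n → Carrier) : Set where
    field
      F-cong : ∀ {w w′} → w ≐₂ w′ → F w ≡ F w′
      F-⊕    : ∀ w w′ → F (w ⊕₂ w′) ≡ F w + F w′
      F-*    : ∀ c w → F (c *₂ w) ≡ c * F w

  -- An isometry is only required to preserve the form on vectors over F_q; the standard
  -- basis consists of such vectors.
  linear-ext : ∀ {n} {F F′ : Vect2 n → Carrier} → IsLinear F → IsLinear F′ →
    (∀ (i : Fin n) → F (idM i , λ _ → 0#) ≡ F′ (idM i , λ _ → 0#)) →
    (∀ (i : Fin n) → F ((λ _ → 0#) , idM i) ≡ F′ ((λ _ → 0#) , idM i)) →
    ∀ w → F w ≡ F′ w
  linear-ext {n} {F} {F′} F-lin F′-lin agree₁ agree₂ (x , y) = begin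
    F (x , y)                                           ≡⟨ split F-lin ⟩
    F (x , λ _ → 0#) + F ((λ _ → 0#) , y)
      ≡⟨ cong₂ _+_ (ext (λ u → u , λ _ → 0#) (λ e → e , λ _ → refl)
          (λ _ _ → (λ _ → refl) , λ _ → sym (+-identityʳ 0#))
          (λ c _ → (λ _ → refl) , λ _ → sym (zeroʳ c)) agree₁ x)
                   (ext (λ u → (λ _ → 0#) , u) (λ e → (λ _ → refl) , e)
                       (λ _ _ → (λ _ → sym (+-identityʳ 0#)) , λ _ → refl)
                       (λ c _ → (λ _ → sym (zeroʳ c)) , λ _ → refl) agree₂ y) ⟩
    F′ (x , λ _ → 0#) + F′ ((λ _ → 0#) , y)             ≡⟨ split F′-lin ⟨
    F′ (x , y)                                          ∎
    where
    open IsLinear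
    split : ∀ {F : Vect2 n → Carrier} → IsLinear F →
        F (x , y) ≡ F (x , λ _ → 0#) + F ((λ _ → 0#) , y)
    split L = trans (F-cong L ((λ i → sym (+-identityʳ (x i))) , (λ i → sym (+-identityˡ (y i)))))
        (F-⊕ L _ _)

    -- The linear map `j` is a parameter so that the number m of coordinates can decrease while the
    -- functionals on K²ⁿ stay fixed.
    ext : ∀ {m} (j : Vect m → Vect2 n) → (∀ {u v} → u ≐ v → j u ≐₂ j v) →
          (∀ u v → j (u ⊕ v) ≐₂ (j u ⊕₂ j v)) → (∀ c u → j (λ i → c * u i) ≐₂ (c *₂ j u)) →
          (∀ i → F (j (idM i)) ≡ F′ (j (idM i))) → ∀ u → F (j u) ≡ F′ (j u)
    ext {zero} j j-cong j-⊕ j-* agree u = trans (zeros F-lin) (sym (zeros F′-lin))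
      where
      zeros : ∀ {F : Vect2 n → Carrier} → IsLinear F → F (j u) ≡ 0#
      zeros {F} L = trans (F-cong L (≐₂-trans (j-cong (λ ())) (j-* 0# u)))
          (trans (F-* L 0# (j u)) (zeroˡ _))
    ext {suc m} j j-cong j-⊕ j-* agree u = begin
      F (j u)                                          ≡⟨ step F-lin ⟩
      u zero * F (j (idM zero)) + F (j (cons0 (u ∘ suc)))
        ≡⟨ cong₂ (λ s t → u zero * s + t) (agree zero)
             (ext (j ∘ cons0) (j-cong ∘ cons0-cong)
               (λ v w → ≐₂-trans (j-cong (λ { zero → sym (+-identityʳ 0#) ; (suc i) → refl }))
                   (j-⊕ _ _))
               (λ c v → ≐₂-trans (j-cong (λ { zero → sym (zeroʳ c) ; (suc i) → refl })) (j-* c _))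
               (λ i → trans (F-cong F-lin (j-cong (shift i)))
                   (trans (agree (suc i)) (sym (F-cong F′-lin (j-cong (shift i))))))
               (u ∘ suc)) ⟩
      u zero * F′ (j (idM zero)) + F′ (j (cons0 (u ∘ suc)))  ≡⟨ step F′-lin ⟨
      F′ (j u)                                         ∎
      where
      cons0 : Vect m → Vect (suc m)
      cons0 v zero    = 0#
      cons0 v (suc i) = v i
      cons0-cong : ∀ {v w} → v ≐ w → cons0 v ≐ cons0 w
      cons0-cong e zero    = refl
      cons0-cong e (suc i) = e i
      shift : ∀ i → cons0 (idM i) ≐ idM (suc i)
      shift i zero    = refl
      shift i (suc k) = refl
      decompose : u ≐ ((λ i → u zero * idM zero i) ⊕ cons0 (u ∘ suc))
      decompose zero    = sym (trans (+-identityʳ _) (*-identityʳ _))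
      decompose (suc i) = sym (trans (cong (_+ u (suc i)) (zeroʳ _)) (+-identityˡ _))
      step : ∀ {F : Vect2 n → Carrier} → IsLinear F →
          F (j u) ≡ u zero * F (j (idM zero)) + F (j (cons0 (u ∘ suc)))
      step {F} L = begin
        F (j u)
          ≡⟨ F-cong L (j-cong decompose) ⟩
        F (j ((λ i → u zero * idM zero i) ⊕ cons0 (u ∘ suc)))                ≡⟨ F-cong L (j-⊕ _ _) ⟩
        F (j (λ i → u zero * idM zero i) ⊕₂ j (cons0 (u ∘ suc)))             ≡⟨ F-⊕ L _ _ ⟩
        F (j (λ i → u zero * idM zero i)) + F (j (cons0 (u ∘ suc)))
          ≡⟨ cong (_+ F (j (cons0 (u ∘ suc)))) (trans (F-cong L (j-* _ _)) (F-* L _ _)) ⟩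
        u zero * F (j (idM zero)) + F (j (cons0 (u ∘ suc)))                  ∎

  sympl-cong : ∀ {n} {w w′ z z′ : Vect2 n} → w ≐₂ w′ → z ≐₂ z′ → sympl w z ≡ sympl w′ z′
  sympl-cong (e₁ , e₂) (f₁ , f₂) = Σ-cong _
      (λ i → cong₂ (λ s t → s + - t) (cong₂ _*_ (e₁ i) (f₂ i)) (cong₂ _*_ (e₂ i) (f₁ i)))

  sympl-linearˡ : ∀ {n} (z : Vect2 n) → IsLinear (λ w → sympl w z)
  sympl-linearˡ {n} z@(x , y) = record
    { F-cong = λ e → sympl-cong e ≐₂-refl
    ; F-⊕    = λ (u , v) (u′ , v′) → trans (Σ-cong n (λ i →
        solve 6 (λ u v u′ v′ x y → (u :+ u′) :* y :+ :- ((v :+ v′) :* x) :=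
            (u :* y :+ :- (v :* x)) :+ (u′ :* y :+ :- (v′ :* x)))
          refl (u i) (v i) (u′ i) (v′ i) (x i) (y i))) (Σ-+ n _ _)
    ; F-*    = λ c (u , v) → trans (Σ-cong n (λ i →
        solve 5 (λ c u v x y → c :* u :* y :+ :- (c :* v :* x) := c :* (u :* y :+ :- (v :* x))) refl
            c (u i) (v i) (x i) (y i))) (Σ-* n c _)
    }

  sympl-linearʳ : ∀ {n} (z : Vect2 n) → IsLinear (λ w → sympl z w)
  sympl-linearʳ {n} z@(x , y) = record
    { F-cong = λ e → sympl-cong ≐₂-refl e
    ; F-⊕    = λ (u , v) (u′ , v′) → trans (Σ-cong n (λ i →
        solve 6 (λ u v u′ v′ x y → x :* (v :+ v′) :+ :- (y :* (u :+ u′)) :=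
            (x :* v :+ :- (y :* u)) :+ (x :* v′ :+ :- (y :* u′)))
          refl (u i) (v i) (u′ i) (v′ i) (x i) (y i))) (Σ-+ n _ _)
    ; F-*    = λ c (u , v) → trans (Σ-cong n (λ i →
        solve 5 (λ c u v x y → x :* (c :* v) :+ :- (y :* (c :* u)) := c :* (x :* v :+ :- (y :* u)))
            refl c (u i) (v i) (x i) (y i))) (Σ-* n c _)
    }

  linear-act : ∀ {n} {F : Vect2 n → Carrier} (g : Block n) → IsLinear F → IsLinear (F ∘ act g)
  linear-act g F-lin = record
    { F-cong = F-cong ∘ act-cong g
    ; F-⊕    = λ w w′ → trans (F-cong (act-⊕ g w w′)) (F-⊕ _ _)
    ; F-*    = λ c w → trans (F-cong (act-* g c w)) (F-* _ _)
    }
    where open IsLinear F-lin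

  linear-* : ∀ {n} {F : Vect2 n → Carrier} k → IsLinear F → IsLinear (λ w → k * F w)
  linear-* {F = F} k F-lin = record
    { F-cong = cong (k *_) ∘ F-cong
    ; F-⊕    = λ w w′ → trans (cong (k *_) (F-⊕ w w′)) (distribˡ k _ _)
    ; F-*    = λ c w → trans (cong (k *_) (F-* c w))
        (solve 3 (λ k c f → k :* (c :* f) := c :* (k :* f)) refl k c (F w))
    }
    where open IsLinear F-lin

-- Conjugation and determinants of hermitian matrices.

module HermitianSpace (K : FiniteField) (p-1 : ℕ) (p-prime : Prime (suc p-1))
  (char-p : HasCharacteristic K (suc p-1))
  (k : ℕ) where
  private
    p = suc p-1
    q = p ℕ.^ suc k

  open FiniteField K
  open FieldProperties K
  open Frobenius K p-1 p-prime char-p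
  open Geometry K q
  open ExteriorAlgebra K q
  open LinearAlgebra K q
  open ≡-Reasoning

  pow≡^ : ∀ x m → pow x m ≡ x ^ m
  pow≡^ x zero    = refl
  pow≡^ x (suc m) = cong (x *_) (pow≡^ x m)

  conj-isEndomorphism : IsEndomorphism conj
  conj-isEndomorphism = record
    { +-homo   = λ x y → trans (conj≡^ (x + y))
        (trans (+-homo x y) (sym (cong₂ _+_ (conj≡^ x) (conj≡^ y))))
    ; *-homo   = λ x y → trans (conj≡^ (x * y))
        (trans (*-homo x y) (sym (cong₂ _*_ (conj≡^ x) (conj≡^ y))))
    ; neg-homo = λ x → trans (conj≡^ (- x)) (trans (neg-homo x) (sym (cong -_ (conj≡^ x))))
    ; 0-homo   = trans (conj≡^ 0#) 0-homo
    ; 1-homo   = trans (conj≡^ 1#) 1-homo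
    }
    where
    conj≡^ : ∀ x → conj x ≡ x ^ q
    conj≡^ x = pow≡^ x q
    open IsEndomorphism (^p^e-isEndomorphism (suc k))

  open IsEndomorphism conj-isEndomorphism

  wedge-conj : ∀ {n} (v : Vect n) {x y} → (∀ s → y s ≡ conj (x s)) → ∀ s →
      wedge (conj ∘ v) y s ≡ conj (wedge v x s)
  wedge-conj v y≡ []            = sym 0-homo
  wedge-conj v y≡ (outside ∷ s) = wedge-conj (v ∘ suc) (λ t → y≡ (outside ∷ t)) s
  wedge-conj v {x} {y} y≡ (inside ∷ s) = begin
    conj (v zero) * y (outside ∷ s) + - wedge (conj ∘ v ∘ suc) (y ∘ (inside ∷_)) s
      ≡⟨ cong₂ (λ a b → conj (v zero) * a + - b) (y≡ (outside ∷ s))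
          (wedge-conj (v ∘ suc) (λ t → y≡ (inside ∷ t)) s) ⟩
    conj (v zero) * conj (x (outside ∷ s)) + - conj w
      ≡⟨ cong₂ _+_ (*-homo _ _) (neg-homo w) ⟨
    conj (v zero * x (outside ∷ s)) + conj (- w)
      ≡⟨ +-homo _ _ ⟨
    conj (v zero * x (outside ∷ s) + - w) ∎
    where w = wedge (v ∘ suc) (x ∘ (inside ∷_)) s

  det-conj : ∀ {n} (A : Mat n) → det (λ i j → conj (A i j)) ≡ conj (det A)
  det-conj {n} A = W-conj (allFin n) ⊤
    where
    W-conj : ∀ l s → W (λ i j → conj (A i j)) l s ≡ conj (W A l s)
    W-conj []      s = one-conj s
      where
      one-conj : ∀ {n} s → one {n} s ≡ conj (one s)
      one-conj []            = sym 1-homo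
      one-conj (outside ∷ s) = one-conj s
      one-conj (inside ∷ s)  = sym 0-homo
    W-conj (i ∷ l) s = wedge-conj (A i) (W-conj l) s

  Hermitian : ∀ {n} → Mat n → Set
  Hermitian A = ∀ i j → A i j ≡ conj (A j i)

  -- Conjugating the entries of a hermitian matrix transposes it, which preserves the determinant.
  det-hermitian : ∀ {n} (A : Mat n) → Hermitian A → conj (det A) ≡ det A
  det-hermitian A A-herm = trans (sym (det-conj A))
      (det-transpose (λ i j → conj (A i j)) A (λ i j → sym (A-herm j i)))

  hermitian⇒unitPower≡1 : ∀ {n} (A : Mat n) → Hermitian A → det A ≢ 0# →
      unitPower (suc k) (det A) ≡ 1#
  hermitian⇒unitPower≡1 A A-herm detA≢0 = *-cancelˡ detA≢0 (begin
    det A * unitPower (suc k) (det A)  ≡⟨ x*unitPower (suc k) (det A) ⟩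
    det A ^ q                          ≡⟨ pow≡^ (det A) q ⟨
    conj (det A)                       ≡⟨ det-hermitian A A-herm ⟩
    det A                              ≡⟨ *-identityʳ _ ⟨
    det A * 1#                         ∎)

  -- The exponent q - 1 must be positive, as 0 ^ 0 = 1. Positivity comes from the exponent `suc k`
  -- and from p > 1.
  unitPower-0 : unitPower (suc k) 0# ≡ 0#
  unitPower-0 = trans (cong (_* unitPower k 0# ^ p)
      (0^p-1 p-1 (ℕ.s<s⁻¹ (ℕ.nonTrivial⇒n>1 p {{prime⇒nonTrivial p-prime}})))) (zeroˡ _)
    where
    0^p-1 : ∀ m → 0 ℕ.< m → 0# ^ m ≡ 0#
    0^p-1 (suc m) _ = zeroˡ _

  wedge-zeroˡ : ∀ {n} {v : Vect n} → IsZero v → ∀ x s → wedge v x s ≡ 0#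
  wedge-zeroˡ v≡0 x []            = refl
  wedge-zeroˡ v≡0 x (outside ∷ s) = wedge-zeroˡ (v≡0 ∘ suc) _ s
  wedge-zeroˡ v≡0 x (inside ∷ s)  = trans
      (cong₂ (λ a b → a * x (outside ∷ s) + - b) (v≡0 zero) (wedge-zeroˡ (v≡0 ∘ suc) _ s))
    (solve 1 (λ x → con 0ℤ :* x :+ :- con 0ℤ := con 0ℤ) refl _)

  -- The empty determinant is 1, hence the bound on `n`.
  det-zero : ∀ {n} → n ℕ.≥ 1 → ∀ {A : Mat n} → A ≐M zeroM → det A ≡ 0#
  det-zero {suc n} _ {A} A≡0 = wedge-zeroˡ {v = A zero} (A≡0 zero) (W A (tabulate suc)) ⊤

  -- The degree argument on a linear spread set.

  module SpreadSet {n} (U : LinearSpreadSet n) where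
    open LinearSpreadSet U

    private
      G = Fin card

    -- Addition is moved to the indices, where `distinct` turns entrywise identities of matrices
    -- into propositional group laws.
    _∙_ : G → G → G
    i ∙ j = proj₁ (addClosed i j)

    elem-∙ : ∀ i j → elem (i ∙ j) ≐M (elem i ⊞ elem j)
    elem-∙ i j = proj₂ (addClosed i j)

    -- Closure under addition yields positive multiples only; the zero matrix is then found as p
    -- times any element of U.
    multiple : ∀ m i → ∃ λ j → ∀ r c → elem j r c ≡ suc m ℕ× elem i r c
    multiple zero    i = i , λ r c → sym (+-identityʳ _)
    multiple (suc m) i with multiple m i
    ... | j , j≡ = i ∙ j , λ r c → trans (elem-∙ i j r c) (cong (elem i r c +_) (j≡ r c))

    card≡p^ : card ≡ p ℕ.^ (suc k ℕ.* n)
    card≡p^ = trans card≡ (ℕₚ.^-*-assoc p (suc k) n)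

    ∃zero : ∃ λ i → elem i ≐M zeroM
    ∃zero with multiple p-1 (subst Fin (sym card≡p^) (Fin.fromℕ< (ℕₚ.m^n>0 p (suc k ℕ.* n))))
    ... | i , i≡ = i , λ r c → trans (i≡ r c) (p∣n⇒n×x≡0 ℕ.∣-refl _)

    ε : G
    ε = proj₁ ∃zero

    elem-ε : elem ε ≐M zeroM
    elem-ε = proj₂ ∃zero

    ∙-isCommutativeMonoid : IsCommutativeMonoid _≡_ _∙_ ε
    ∙-isCommutativeMonoid = record
      { isMonoid = record
        { isSemigroup = record
          { isMagma = record { isEquivalence = ≡-isEquivalence ; ∙-cong = cong₂ _∙_ }
          ; assoc = λ x y z → distinct _ _ λ r c → begin
              elem ((x ∙ y) ∙ z) r c                      ≡⟨ elem-∙ (x ∙ y) z r c ⟩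
              elem (x ∙ y) r c + elem z r c               ≡⟨ cong (_+ elem z r c) (elem-∙ x y r c) ⟩
              (elem x r c + elem y r c) + elem z r c      ≡⟨ +-assoc _ _ _ ⟩
              elem x r c + (elem y r c + elem z r c)      ≡⟨ cong (elem x r c +_) (elem-∙ y z r c) ⟨
              elem x r c + elem (y ∙ z) r c               ≡⟨ elem-∙ x (y ∙ z) r c ⟨
              elem (x ∙ (y ∙ z)) r c                      ∎ }
        ; identity = identityˡ , λ x → trans (∙-comm x ε) (identityˡ x) }
      ; comm = ∙-comm }
      where
      ∙-comm : ∀ x y → x ∙ y ≡ y ∙ x
      ∙-comm x y = distinct _ _ λ r c → trans (elem-∙ x y r c)
          (trans (+-comm _ _) (sym (elem-∙ y x r c)))
      identityˡ : ∀ x → ε ∙ x ≡ x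
      identityˡ x = distinct _ _ λ r c → trans (elem-∙ ε x r c)
          (trans (cong (_+ elem x r c) (elem-ε r c)) (+-identityˡ _))

    open ElementaryAbelian K p-1 p-prime char-p ∙-isCommutativeMonoid using (monoid; delta-degree)
    open FiniteDifferences K p-1 p-prime char-p _∙_
    open Determinants K q p-1 p-prime char-p _∙_
    open import Algebra.Properties.Monoid.Mult monoid using () renaming (_×_ to _⊛_)

    p⊛x≡ε : ∀ x → p ⊛ x ≡ ε
    p⊛x≡ε x = distinct _ _ λ r c → trans (elem-⊛ p r c)
        (trans (p∣n⇒n×x≡0 ℕ.∣-refl _) (sym (elem-ε r c)))
      where
      elem-⊛ : ∀ m r c → elem (m ⊛ x) r c ≡ m ℕ× elem x r c
      elem-⊛ zero    r c = elem-ε r c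
      elem-⊛ (suc m) r c = trans (elem-∙ x (m ⊛ x) r c) (cong (elem x r c +_) (elem-⊛ m r c))

    ∃singular : n ℕ.≥ 1 → ∀ B → Hermitian B → ¬ (∀ i → Injective-· (elem i ⊖ B))
    ∃singular n≥1 B B-herm regular =
      delta-degree p⊛x≡ε (suc k ℕ.* n) (sym card≡p^) e e≡0 e≢0
          (subst (λ m → DegreeBelow m e) degree≡ (difference e-leading))
      where
      D D₀ e : G → Carrier
      D i  = det (elem i ⊖ B)
      D₀ i = det (elem i)
      e i  = unitPower (suc k) (D i) + - unitPower (suc k) (D₀ i)

      -- The bound delivered by `leading-unitPower` equals d (p - 1) for the dimension d = (k + 1) n
      -- of U over 𝔽ₚ, which is exactly the bound that `delta-degree` refutes.
      degree≡ : suc k ℕ.* (p-1 ℕ.* n) ≡ suc k ℕ.* n ℕ.* p-1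
      degree≡ = trans (cong (suc k ℕ.*_) (ℕₚ.*-comm p-1 n)) (sym (ℕₚ.*-assoc (suc k) n p-1))

      -- Entries are additive on U, so their differences are constant: degree at most 1.
      elem-below : ∀ r c → DegreeBelow 2 (λ i → elem i r c)
      elem-below r c v = below-cong 1 (λ i →
          trans (solve 2 (λ a b → b := (a :+ b) :+ :- a) refl (elem i r c) (elem v r c))
        (cong (_+ - elem i r c) (sym (elem-∙ i v r c)))) (below-const (elem v r c))

      e-leading : SameLeadingPart (suc k ℕ.* (p-1 ℕ.* n)) (unitPower (suc k) ∘ D)
          (unitPower (suc k) ∘ D₀)
      -- Corresponding entries of A - B and A differ by the constant -B r c, so their parts of
      -- degree 1 agree.
      e-leading = leading-unitPower (suc k) (leading-det (λ i → elem i ⊖ B) elem λ r c → leading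
        (below-+ 2 (elem-below r c) (below-suc 1 (below-const (- B r c)))) (elem-below r c)
        (below-cong 1 (λ i → solve 2 (λ a b → b := (a :+ b) :+ :- a) refl (elem i r c) (- B r c))
            (below-const (- B r c))))

      elem-herm : ∀ i → Hermitian (elem i)
      elem-herm i r c = trans (symm i r c) (sym (overFq i c r))

      unitPower-D : ∀ i → unitPower (suc k) (D i) ≡ 1#
      unitPower-D i = hermitian⇒unitPower≡1 (elem i ⊖ B) (λ r c → trans
        (cong₂ (λ a b → a + - b) (elem-herm i r c) (B-herm r c))
            (sym (trans (+-homo _ _) (cong (conj (elem i c r) +_) (neg-homo _)))))
        (injective⇒det-nonzero (elem i ⊖ B) (regular i))

      e≡0 : ∀ i → i ≢ ε → e i ≡ 0#
      e≡0 i i≢ε = trans (cong₂ (λ a b → a + - b) (unitPower-D i)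
        (hermitian⇒unitPower≡1 (elem i) (elem-herm i) (invertible⇒det-nonzero (elem i)
          (nonzeroInv i (λ i≡0 → i≢ε (distinct i ε
              (λ r c → trans (i≡0 r c) (sym (elem-ε r c)))))))))
        (-‿inverseʳ 1#)

      -- At the zero matrix the terms are 1 and 0: the determinant of 0 - B is nonzero by
      -- assumption, that of 0 is not.
      e≢0 : e ε ≢ 0#
      e≢0 eε≡0 = 0≢1 (trans (sym eε≡0) (trans (cong₂ (λ a b → a + - b) (unitPower-D ε)
        (trans (cong (unitPower (suc k)) (det-zero n≥1 elem-ε)) unitPower-0))
            (solve 0 (con 1ℤ :+ :- con 0ℤ := con 1ℤ) refl)))

  -- Isometries and the hermitian form.

  conj₂ : ∀ {n} → Vect2 n → Vect2 n
  conj₂ (x , y) = conj ∘ x , conj ∘ y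

  Σ-conj : ∀ n (f : Vect n) → conj (Σ n f) ≡ Σ n (conj ∘ f)
  Σ-conj zero    f = 0-homo
  Σ-conj (suc n) f = trans (+-homo _ _) (cong (conj (f zero) +_) (Σ-conj n (f ∘ suc)))

  -- Reduces the hermitian form to the symplectic one, about which the isometry `g` gives
  -- information.
  herm≡sympl : ∀ {n} a (w w′ : Vect2 n) → herm a w w′ ≡ a * sympl w (conj₂ w′)
  herm≡sympl {n} a (x , y) (x′ , y′) = trans
    (Σ-cong n (λ i → solve 5 (λ a x y u v → a :* x :* v :+ :- (a :* y :* u) :=
        a :* (x :* v :+ :- (y :* u))) refl a (x i) (y i) (conj (x′ i)) (conj (y′ i))))
    (Σ-* n a _)

  act-conj : ∀ {n} (g : Block n) → BlockFq g → ∀ w → conj₂ (act g w) ≐₂ act g (conj₂ w)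
  act-conj {n} (block a b c d) (aFq , bFq , cFq , dFq) (x , y) = row aFq bFq , row cFq dFq
    where
    ·-conj : ∀ {A : Mat n} → MatFq A → ∀ u i → conj ((A · u) i) ≡ (A · (conj ∘ u)) i
    ·-conj {A} AFq u i = trans (Σ-conj n _)
        (Σ-cong n (λ j → trans (*-homo _ _) (cong (_* conj (u j)) (AFq i j))))
    row : ∀ {A B : Mat n} → MatFq A → MatFq B → ∀ i →
        conj ((A · x) i + (B · y) i) ≡ (A · (conj ∘ x)) i + (B · (conj ∘ y)) i
    row AFq BFq i = trans (+-homo _ _) (cong₂ _+_ (·-conj AFq x i) (·-conj BFq y i))

  idM-Fq : ∀ {n} (i : Fin n) → VectFq (idM i)
  idM-Fq zero    zero    = 1-homo
  idM-Fq zero    (suc j) = 0-homo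
  idM-Fq (suc i) zero    = 0-homo
  idM-Fq (suc i) (suc j) = idM-Fq i j

  -- Scalars are extended one argument at a time: `overK` frees w while w′ is still over 𝔽_q, and
  -- then w′ is freed.
  sympl-act : ∀ {n} (g : Block n) l →
    (∀ w w′ → (VectFq (proj₁ w) × VectFq (proj₂ w)) → (VectFq (proj₁ w′) × VectFq (proj₂ w′)) →
        sympl (act g w) (act g w′) ≡ l * sympl w w′) →
    ∀ w w′ → sympl (act g w) (act g w′) ≡ l * sympl w w′
  sympl-act g l preserves w w′ = linear-ext
    (linear-act g (sympl-linearʳ (act g w))) (linear-* l (sympl-linearʳ w))
    (λ i → overK (idM i , λ _ → 0#) (idM-Fq i , λ _ → 0-homo) w)
        (λ i → overK ((λ _ → 0#) , idM i) ((λ _ → 0-homo) , idM-Fq i) w) w′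
    where
    overK : ∀ w′ → (VectFq (proj₁ w′) × VectFq (proj₂ w′)) → ∀ w →
        sympl (act g w) (act g w′) ≡ l * sympl w w′
    overK w′ w′Fq = linear-ext (linear-act g (sympl-linearˡ (act g w′)))
        (linear-* l (sympl-linearˡ w′))
      (λ i → preserves _ w′ (idM-Fq i , λ _ → 0-homo) w′Fq)
          (λ i → preserves _ w′ ((λ _ → 0-homo) , idM-Fq i) w′Fq)

  -- The entries of `g` lie in 𝔽_q, so `g` commutes with conjugation and scales the hermitian form
  -- by the same factor.
  herm-act : ∀ {n} a (g : Block n) → BlockFq g → ∀ l →
    (∀ w w′ → (VectFq (proj₁ w) × VectFq (proj₂ w)) → (VectFq (proj₁ w′) × VectFq (proj₂ w′)) →
        sympl (act g w) (act g w′) ≡ l * sympl w w′) →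
    ∀ w w′ → herm a (act g w) (act g w′) ≡ l * herm a w w′
  herm-act a g gFq l preserves w w′ = begin
    herm a (act g w) (act g w′)               ≡⟨ herm≡sympl a (act g w) (act g w′) ⟩
    a * sympl (act g w) (conj₂ (act g w′))
      ≡⟨ cong (a *_) (sympl-cong ≐₂-refl (act-conj g gFq w′)) ⟩
    a * sympl (act g w) (act g (conj₂ w′))
      ≡⟨ cong (a *_) (sympl-act g l preserves w (conj₂ w′)) ⟩
    a * (l * sympl w (conj₂ w′))
      ≡⟨ solve 3 (λ a l s → a :* (l :* s) := l :* (a :* s)) refl a l _ ⟩
    l * (a * sympl w (conj₂ w′))              ≡⟨ cong (l *_) (herm≡sympl a w w′) ⟨
    l * herm a w w′                           ∎

  herm-cong : ∀ {n} a {w w′ z z′ : Vect2 n} → w ≐₂ w′ → z ≐₂ z′ → herm a w z ≡ herm a w′ z′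
  herm-cong a {w} {w′} {z} {z′} e (f , f′) = trans (herm≡sympl a w z)
    (trans (cong (a *_) (sympl-cong e ((λ i → cong conj (f i)) , (λ i → cong conj (f′ i)))))
        (sym (herm≡sympl a w′ z′)))

  -- For u = B e_i and v = B e_j the bracket is conj B_ij - B_ji, so isotropy of the graph of B
  -- means that B is hermitian.
  herm-graph : ∀ {n} a (i j : Fin n) (u v : Vect n) →
      herm a (idM i , u) (idM j , v) ≡ a * (conj (v i) + - u j)
  herm-graph {n} a i j u v = trans (herm≡sympl a (idM i , u) (idM j , v)) (cong (a *_) (begin
    Σ n (λ m → idM i m * conj (v m) + - (u m * conj (idM j m)))   ≡⟨ Σ-+ n _ _ ⟩
    idM i • (conj ∘ v) + Σ n (λ m → - (u m * conj (idM j m)))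
      ≡⟨ cong₂ _+_ (idM-• i (conj ∘ v)) (Σ-neg n _) ⟩
    conj (v i) + - Σ n (λ m → u m * conj (idM j m))
      ≡⟨ cong (λ s → conj (v i) + - s) (begin
      Σ n (λ m → u m * conj (idM j m))
        ≡⟨ Σ-cong n (λ m → trans (cong (u m *_) (idM-Fq j m)) (*-comm _ _)) ⟩
      idM j • u                           ≡⟨ idM-• j u ⟩
      u j                                 ∎) ⟩
    conj (v i) + - u j                                            ∎))

  -- Generators pulled back along the isometry.

  module _ {n : ℕ} (n≥1 : n ℕ.≥ 1) (a : Carrier) (a≢0 : a ≢ 0#) (U : LinearSpreadSet n)
      (g : Block n) (g-isom : IsometryW g) where
    open LinearSpreadSet U using (card; elem)

    private
      h = proj₁ (proj₁ (proj₂ g-isom))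
      hg≐id = proj₂ (proj₂ (proj₁ (proj₂ g-isom)))
      l = proj₁ (proj₂ (proj₂ g-isom))
      l≢0 = proj₁ (proj₂ (proj₂ (proj₂ (proj₂ g-isom))))
      preserves = proj₂ (proj₂ (proj₂ (proj₂ (proj₂ g-isom))))

    -- The matrices of g⁻¹W.
    module Pullback (W : Gen n) (W-iso : TotIsoH a W) where
      open Gen W renaming (top to P; bot to Q)
      open Block

      P′ Q′ : Mat n
      P′ = (g₁₁ h ⊠ P) ⊞ (g₁₂ h ⊠ Q)
      Q′ = (g₂₁ h ⊠ P) ⊞ (g₂₂ h ⊠ Q)

      act-pullback : ∀ u → act g (P′ · u , Q′ · u) ≐₂ apply W u
      act-pullback u = ≐₂-trans (act-cong g (row (g₁₁ h) (g₁₂ h) , row (g₂₁ h) (g₂₂ h)))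
          (rightInverse g h hg≐id (apply W u))
        where
        row : ∀ A B → (((A ⊠ P) ⊞ (B ⊠ Q)) · u) ≐ ((A · (P · u)) ⊕ (B · (Q · u)))
        row A B i = trans (⊞-· (A ⊠ P) (B ⊠ Q) u i) (cong₂ _+_ (⊠-· A P u i) (⊠-· B Q u i))

      isotropic : ∀ u v → herm a (P′ · u , Q′ · u) (P′ · v , Q′ · v) ≡ 0#
      isotropic u v = x*y≡0⇒y≡0 l≢0 (trans (sym (herm-act a g (proj₁ g-isom) l preserves _ _))
        (trans (herm-cong a (act-pullback u) (act-pullback v)) (W-iso u v)))

      -- A kernel vector u of `P′` gives the vector (0, Q′ u) of g⁻¹W, which lies in S∞.
      Kernel : Vect n → Set
      Kernel u = ¬ IsZero u × IsZero (P′ · u)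

      -- An exhaustive search through the codes of vectors makes the case distinction in `maximal`
      -- constructive; `eigen?` does the same for the final contradiction.
      kernel? : Dec (∃ Kernel)
      kernel? = Coding.any? (Vect-coding n)
        (λ u≐v (u≢0 , P′u≡0) → (λ v≡0 → u≢0 (λ i → trans (u≐v i) (v≡0 i))) , λ i →
            trans (sym (·-cong P′ u≐v i)) (P′u≡0 i))
        (λ u → ¬? (isZero? u) ×-dec isZero? (P′ · u))

      kernel⇒meet : ∃ Kernel → Meet W (gS∞ g)
      kernel⇒meet (u , u≢0 , P′u≡0) = u , Q′ · u , u≢0 ,
        ≐₂-trans (≐₂-sym (act-pullback u)) ((λ i → drop (g₁₁ g) i) , (λ i → drop (g₂₁ g) i))
        where
        drop : ∀ A i {x} → (A · (P′ · u)) i + x ≡ x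
        drop A i = trans (cong (_+ _) (·-zero A P′u≡0 i)) (+-identityˡ _)

      module _ (P′-inj : Injective-· P′) where

        -- `R` is a right inverse of `P′`. Substituting R u for the parameter turns g⁻¹W into the
        -- graph of all (u, B u).
        R B : Mat n
        R i j = proj₁ (injective⇒solvable P′ P′-inj (idM j)) i
        B = Q′ ⊠ R

        P′⊠R≐id : ∀ i j → (P′ ⊠ R) i j ≡ idM j i
        P′⊠R≐id i j = proj₂ (injective⇒solvable P′ P′-inj (idM j)) i

        P′R : ∀ u → (P′ · (R · u)) ≐ u
        P′R u i = trans (sym (⊠-· P′ R u i))
          (trans (Σ-cong n (λ j → cong (_* u j) (trans (P′⊠R≐id i j) (idM-sym j i)))) (idM-• i u))

        B-hermitian : Hermitian B
        B-hermitian i j = sym (x-y≡0⇒x≡y (x*y≡0⇒y≡0 a≢0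
            (trans (sym (herm-graph a j i (column B j) (column B i)))
          (trans (herm-cong a ((λ r → sym (P′⊠R≐id r j)) , λ _ → refl)
              ((λ r → sym (P′⊠R≐id r i)) , λ _ → refl))
                 (isotropic (column R j) (column R i))))))
          where
          column : Mat n → Fin n → Vect n
          column M j i = M i j

        -- The graphs of `B` and of `elem i` share the point (u, B u).
        Eigen : Fin card → Vect n → Set
        Eigen i u = ¬ IsZero u × ((B · u) ≐ (elem i · u))

        eigen? : Dec (∃ λ i → ∃ (Eigen i))
        eigen? = Finₚ.any? (λ i → Coding.any? (Vect-coding n)
          (λ u≐v (u≢0 , Bu≐Au) → (λ v≡0 → u≢0 (λ r → trans (u≐v r) (v≡0 r))) ,
             λ r → trans (sym (·-cong B u≐v r)) (trans (Bu≐Au r) (·-cong (elem i) u≐v r)))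
          (λ u → ¬? (isZero? u) ×-dec ((B · u) ≐? (elem i · u))))

        eigen⇒meet : ∀ {i} → ∃ (Eigen i) → Meet W (gS g (elem i))
        eigen⇒meet {i} (u , u≢0 , Bu≐Au) = R · u , u ,
          (λ Ru≡0 → u≢0 (λ r → trans (sym (P′R u r)) (·-zero P′ Ru≡0 r))) ,
          ≐₂-trans (≐₂-sym (act-pullback (R · u)))
            (≐₂-trans (act-cong g (P′R u , λ r → trans (sym (⊠-· Q′ R u r)) (Bu≐Au r)))
              (row (g₁₁ g) (g₁₂ g) , row (g₂₁ g) (g₂₂ g)))
          where
          row : ∀ A B → ((A · u) ⊕ (B · (elem i · u))) ≐ ((A ⊞ (B ⊠ elem i)) · u)
          row A B r = sym (trans (⊞-· A (B ⊠ elem i) u r)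
              (cong ((A · u) r +_) (⊠-· B (elem i) u r)))

        ∃eigen : ∃ λ i → ∃ (Eigen i)
        ∃eigen = decidable-stable eigen? λ none →
            SpreadSet.∃singular U n≥1 B B-hermitian λ i u A-Bu≡0 →
          decidable-stable (isZero? u) λ u≢0 → none (i , u , u≢0 , λ r →
            sym (x-y≡0⇒x≡y (trans (sym (⊖-· (elem i) B u r)) (A-Bu≡0 r))))

    maximal : MaximalExtension a U g
    maximal W _ W-iso with Pullback.kernel? W W-iso
    ... | yes kernel = inj₂ (Pullback.kernel⇒meet W W-iso kernel)
    ... | no  none   = inj₁ (proj₁ eigen , Pullback.eigen⇒meet W W-iso P′-inj (proj₂ eigen))
      where
      P′-inj : Injective-· (Pullback.P′ W W-iso)
      P′-inj u P′u≡0 = decidable-stable (isZero? u) λ u≢0 → none (u , u≢0 , P′u≡0)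
      eigen = Pullback.∃eigen W W-iso P′-inj

open import Data.Nat using (_*_; _^_; _≥_)

theorem5p3 : (K : FiniteField) (q : ℕ) →
    (∃ λ p → ∃ λ k → Prime p × q ≡ p ^ suc k) →
    FiniteField.size K ≡ q * q →
    (n : ℕ) → n ≥ 1 →
    (a : FiniteField.Carrier K) → a ≢ FiniteField.0# K →
    Geometry.conj K q a ≡ FiniteField.-_ K a →
    (U : Geometry.LinearSpreadSet K q n) →
    (g : Geometry.Block K q n) → Geometry.IsometryW K q g →
    Geometry.MaximalExtension K q a U g
theorem5p3 K q (zero , k , p-prime , _) _ =
  ⊥-elim (ℕₚ.n≮0 (ℕ.nonTrivial⇒n>1 0 {{prime⇒nonTrivial p-prime}}))
theorem5p3 K q (p@(suc p-1) , k , p-prime , refl) size≡ n n≥1 a a≢0 _ U g g-isom =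
  HermitianSpace.maximal K p-1 p-prime char-p k n≥1 a a≢0 U g g-isom
  where
  -- The order q * q of K is p to the power (k + 1) + (k + 1), a power of p.
  char-p = FieldProperties.characteristic K p (suc k ℕ.+ suc k)
    (trans size≡ (sym (ℕₚ.^-distribˡ-+-* p (suc k) (suc k))))
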